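{- Let $n\ge 2$, $a_1,\ldots,a_{n-1}$ nonnegative integers and $\lambda=\sum a_i\omega_i$. For every $w\in S_n$ the point $T_w$ is a vertex of $P_\lambda$. Moreover, $\{T_w: w\in S_n\}=\{x(E): E\in\mathbf R_p\}$, where $\mathbf R_p$ is the set of all $E\subset R$ such that for any two segments in $E$ with nonempty intersection, this intersection belongs to $E$.
   Context: Let $U=\mathbb R^{\binom n2}$ with coordinates $x_{i,j}$, $1\le i<j\le n$. A Dyck path is a sequence $d=((i_1,j_1),\ldots,(i_N,j_N))$ of pairs with $1\le i_k<j_k\le n$, $j_1-i_1=j_N-i_N=1$, and each $(i_{k+1},j_{k+1})$ equal to $(i_k+1,j_k)$ or $(i_k,j_k+1)$. Put $S(x,d)=\sum_{(i,j)\in d}x_{i,j}$ and $M(\lambda,d)=a_{i_1}+a_{i_1+1}+\ldots+a_{i_N}$. The FFLV polytope is $P_\lambda=\{x\in U: x\ge 0,\ S(x,d)\le M(\lambda,d)\ \forall d\}$ and $\Pi_\lambda=P_\lambda\cap\mathbb Z^{\binom n2}$. Let $\alpha_1,\ldots,\alpha_{n-1}$ be the simple roots of $\mathfrak{sl}_n$, $\alpha_{i,j}=\alpha_i+\ldots+\alpha_{j-1}$, $\varepsilon_i=\omega_i-\omega_{i-1}$ ($\omega_0=\omega_n=0$); the Weyl group $S_n$ acts on weights by $w\varepsilon_i=\varepsilon_{w(i)}$. For $T\in\Pi_\lambda$ let $\mu_T=\lambda-\sum_{i<j}T_{i,j}\alpha_{i,j}$ (the weight of the FFLV basis vector $v_T$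 in the irreducible module $L_\lambda$); for every $w\in S_n$ there is a unique $T_w\in\Pi_\lambda$ with $\mu_{T_w}=w\lambda$. Let $R$ be the set of segments $[i,j]$ with integers $1\le i<j\le n$. For $i<j$ let $d^{i,j}=((i,i+1),(i,i+2),\ldots,(i,j),(i+1,j),\ldots,(j-1,j))$. For $E\subset R$, $x(E)\in U$ is the unique point with $x(E)_{i,j}=0$ if $[i,j]\notin E$ and $S(x(E),d^{i,j})=a_i+\ldots+a_{j-1}$ if $[i,j]\in E$.
   Formalization: The polytope P_λ and its ambient space are taken over the rational numbers instead of the reals; "vertex" means that the point is not a proper convex combination, with rational weight, of two distinct rational points of P_λ. -}

module Defs where

open import Data.Nat as ℕ using (ℕ; zero; suc; _∸_)
open import Data.Bool using (Bool; true; false; T)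
open import Data.Integer as ℤ using (ℤ)
open import Data.Rational as ℚ using (ℚ; 0ℚ; 1ℚ)
open import Data.List using (List; []; _∷_; map; _++_; foldr)
open import Data.List.Relation.Unary.All using (All)
open import Data.Product using (_×_; _,_; Σ-syntax)
open import Data.Sum using (_⊎_)
open import Data.Unit using (⊤)
open import Data.Empty using (⊥)
open import Relation.Binary.PropositionalEquality using (_≡_)
open import Relation.Nullary using (¬_; yes; no)

-- Conventions: indices are 1-based natural numbers as in the paper.
-- A point of U = ℝ^(n choose 2) is represented (over ℚ) by a function
-- x : ℕ → ℕ → ℚ, of which only the values x i j with 1 ≤ i < j ≤ n matter.

Valid : ℕ → ℕ → ℕ → Set
Valid n i j = (1 ℕ.≤ i) × (i ℕ.< j) × (j ℕ.≤ n)

Pt : Set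
Pt = ℕ → ℕ → ℚ

sumR : ∀ {A : Set} → (A → A → A) → A → (ℕ → A) → ℕ → ℕ → A
sumR _⊕_ e f i zero    = e
sumR _⊕_ e f i (suc l) = f i ⊕ sumR _⊕_ e f (suc i) l

sumℕ : (ℕ → ℕ) → ℕ → ℕ → ℕ
sumℕ f i k = sumR ℕ._+_ 0 f i (suc k ∸ i)

range : ℕ → ℕ → List ℕ
range i zero    = []
range i (suc l) = i ∷ range (suc i) l

Diag : ℕ × ℕ → Set
Diag (i , j) = j ≡ suc i

StartsDiag : List (ℕ × ℕ) → Set
StartsDiag []      = ⊥
StartsDiag (p ∷ _) = Diag p

EndsDiag : List (ℕ × ℕ) → Set
EndsDiag []           = ⊥
EndsDiag (p ∷ [])     = Diag p
EndsDiag (p ∷ q ∷ r)  = EndsDiag (q ∷ r)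

Chain : List (ℕ × ℕ) → Set
Chain []                          = ⊤
Chain (_ ∷ [])                    = ⊤
Chain ((i , j) ∷ (i' , j') ∷ r)   =
  ((i' ≡ suc i × j' ≡ j) ⊎ (i' ≡ i × j' ≡ suc j)) × Chain ((i' , j') ∷ r)

IsDyck : ℕ → List (ℕ × ℕ) → Set
IsDyck n d = All (λ p → Valid n (Data.Product.proj₁ p) (Data.Product.proj₂ p)) d
           × StartsDiag d × EndsDiag d × Chain d

S : Pt → List (ℕ × ℕ) → ℚ
S x d = foldr (λ p acc → x (Data.Product.proj₁ p) (Data.Product.proj₂ p) ℚ.+ acc) 0ℚ d

firstI : List (ℕ × ℕ) → ℕ
firstI []            = 0
firstI ((i , _) ∷ _) = i

lastI : List (ℕ × ℕ) → ℕ
lastI []             = 0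
lastI ((i , _) ∷ []) = i
lastI (_ ∷ q ∷ r)    = lastI (q ∷ r)

-- M(λ,d) = a_{i_1} + ... + a_{i_N}; λ = Σ a_i ω_i is given by a : ℕ → ℕ
-- (only a 1, ..., a (n-1) are relevant).
M : (ℕ → ℕ) → List (ℕ × ℕ) → ℕ
M a d = sumℕ a (firstI d) (lastI d)

ℕ→ℚ : ℕ → ℚ
ℕ→ℚ k = ℤ.+ k ℚ./ 1

ℤ→ℚ : ℤ → ℚ
ℤ→ℚ z = z ℚ./ 1

InP : ℕ → (ℕ → ℕ) → Pt → Set
InP n a x = (∀ i j → Valid n i j → 0ℚ ℚ.≤ x i j)
          × (∀ d → IsDyck n d → S x d ℚ.≤ ℕ→ℚ (M a d))

_≈[_]_ : Pt → ℕ → Pt → Set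
x ≈[ n ] y = ∀ i j → Valid n i j → x i j ≡ y i j

IsVertex : ℕ → (ℕ → ℕ) → Pt → Set
IsVertex n a x = InP n a x
  × (∀ (y z : Pt) (t : ℚ) → InP n a y → InP n a z → 0ℚ ℚ.< t → t ℚ.< 1ℚ
     → x ≈[ n ] (λ i j → t ℚ.* y i j ℚ.+ (1ℚ ℚ.- t) ℚ.* z i j)
     → y ≈[ n ] z)

ZPt : Set
ZPt = ℕ → ℕ → ℤ

toPt : ZPt → Pt
toPt T i j = ℤ→ℚ (T i j)

InΠ : ℕ → (ℕ → ℕ) → ZPt → Set
InΠ n a T = InP n a (toPt T)

-- Weights, in coordinates w.r.t. the fundamental weights ω_1..ω_{n-1}
-- (a weight is μ : ℕ → ℤ, coordinate m meaningful for 1 ≤ m ≤ n-1).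

Wt : Set
Wt = ℕ → ℤ

_⊕_ : Wt → Wt → Wt
(μ ⊕ ν) m = μ m ℤ.+ ν m

_⊖_ : Wt → Wt → Wt
(μ ⊖ ν) m = μ m ℤ.- ν m

_·_ : ℤ → Wt → Wt
(c · μ) m = c ℤ.* μ m

0w : Wt
0w _ = ℤ.0ℤ

-- ω_k; ω_k = 0 unless 1 ≤ k ≤ n-1 (so ω_0 = ω_n = 0)
ω : ℕ → ℕ → Wt
ω n k m with k ℕ.≟ m | 1 ℕ.≤? k | k ℕ.<? n
... | yes _ | yes _ | yes _ = ℤ.1ℤ
... | _     | _     | _     = ℤ.0ℤ

ε : ℕ → ℕ → Wt
ε n i = ω n i ⊖ ω n (i ∸ 1)

α : ℕ → ℕ → Wt
α n k = ε n k ⊖ ε n (suc k)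

sumW : (ℕ → Wt) → ℕ → ℕ → Wt
sumW f i j = sumR _⊕_ 0w f i (j ∸ i)

αij : ℕ → ℕ → ℕ → Wt
αij n i j = sumW (α n) i j

lam : ℕ → (ℕ → ℕ) → Wt
lam n a = sumW (λ i → (ℤ.+ (a i)) · ω n i) 1 n

μ : ℕ → (ℕ → ℕ) → ZPt → Wt
μ n a T = lam n a ⊖ sumW (λ i → sumW (λ j → T i j · αij n i j) (suc i) (suc n)) 1 (suc n)

IsPerm : ℕ → (ℕ → ℕ) → Set
IsPerm n w = (∀ i → 1 ℕ.≤ i → i ℕ.≤ n → (1 ℕ.≤ w i) × (w i ℕ.≤ n))
           × (∀ i j → 1 ℕ.≤ i → i ℕ.≤ n → 1 ℕ.≤ j → j ℕ.≤ n → w i ≡ w j → i ≡ j)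

-- wλ, using λ = Σ_i a_i ω_i = Σ_i a_i (ε_1 + ... + ε_i) and w ε_k = ε_{w(k)}
wlam : ℕ → (ℕ → ℕ) → (ℕ → ℕ) → Wt
wlam n a w = sumW (λ i → (ℤ.+ (a i)) · sumW (λ k → ε n (w k)) 1 (suc i)) 1 n

_≈w[_]_ : Wt → ℕ → Wt → Set
μ₁ ≈w[ n ] μ₂ = ∀ m → 1 ℕ.≤ m → m ℕ.< n → μ₁ m ≡ μ₂ m

-- a subset E ⊂ R: [i,j] ∈ E iff T (E i j) (only valid pairs matter)
Subset : Set
Subset = ℕ → ℕ → Bool

-- E ∈ R_p: for [i,j],[k,l] ∈ E whose intersection (as sets of integers)
-- [max i k, min j l] is nonempty, that intersection is a segment of E.
InRp : ℕ → Subset → Set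
InRp n E = ∀ i j k l → Valid n i j → Valid n k l → T (E i j) → T (E k l)
  → ℕ._⊔_ i k ℕ.≤ ℕ._⊓_ j l
  → (ℕ._⊔_ i k ℕ.< ℕ._⊓_ j l) × T (E (ℕ._⊔_ i k) (ℕ._⊓_ j l))

dpath : ℕ → ℕ → List (ℕ × ℕ)
dpath i j = map (λ k → (i , k)) (range (suc i) (j ∸ i))
         ++ map (λ k → (k , j)) (range (suc i) (j ∸ suc i))

-- x is the point x(E)  (x(E) is the unique point with these properties)
IsXE : ℕ → (ℕ → ℕ) → Subset → Pt → Set
IsXE n a E x = (∀ i j → Valid n i j → ¬ T (E i j) → x i j ≡ 0ℚ)
             × (∀ i j → Valid n i j → T (E i j) → S x (dpath i j) ≡ ℕ→ℚ (sumℕ a i (j ∸ 1)))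

{-# OPTIONS --safe #-}
module Submission where

-- T_w is Σ_k a_k T^(k), where T^(k) is the 0/1 point whose support (the arcs of
-- level k) is the nested matching of {1,…,k} ∖ w{1,…,k} with w{1,…,k} ∖ {1,…,k}.
-- Arcs of one level are strictly nested, so a Dyck path contains at most one of
-- them; hence T_w ∈ P_λ.  Let E be the set of all arcs of all levels.  For
-- [i,j] ∈ E and i ≤ k < j the path d^{i,j} contains an arc of level k, so
-- T_w = x(E), and x(E) is the only point of P_λ on the faces that define it.
-- Conversely, E ∈ R_p yields arcs of level k by a greedy choice in order of
-- increasing length; the k-subsets obtained from {1,…,k} by exchanging left ends
-- of arcs for right ends increase with k, so they form the flag of a permutation.

open import Defs
open import Algebra.Bundles using (CommutativeRing; CommutativeSemiring)
open import Data.Bool.Base using (T)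
open import Data.Bool.Properties using (T?)
open import Data.Empty using (⊥)
open import Data.Integer.Base as ℤ using (ℤ)
import Data.Integer.Properties as ℤ
open import Data.Integer.Tactic.RingSolver using (solve-∀)
open import Data.List.Base using (List; []; _∷_; foldr; map; _++_)
open import Data.List.Membership.Propositional using (_∈_)
open import Data.List.Membership.Propositional.Properties using (∈-map⁺; ∈-++⁺ˡ; ∈-++⁺ʳ)
open import Data.List.Properties using (++-assoc; map-++)
open import Data.List.Relation.Unary.All as All using (All; []; _∷_)
import Data.List.Relation.Unary.All.Properties as All
open import Data.List.Relation.Unary.Any using (here; there)
open import Data.Nat.Base
open import Data.Nat.Induction using (<-wellFounded)
open import Data.Nat.Properties
open import Data.Product.Base using (∃-syntax; Σ-syntax; _×_; _,_; proj₁; proj₂)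
open import Data.Rational.Base as ℚ using (0ℚ; 1ℚ)
import Data.Rational.Properties as ℚ
open import Data.Rational.Solver using (module +-*-Solver)
open import Data.Rational.Unnormalised.Base as ℚᵘ using (mkℚᵘ; *≡*; *≤*)
import Data.Rational.Unnormalised.Properties as ℚᵘ
open import Data.Sum.Base using (_⊎_; inj₁; inj₂)
open import Function.Base using (_∘_)
open import Induction.WellFounded using (Acc; acc)
open import Level using (0ℓ)
open import Relation.Binary.PropositionalEquality
open import Relation.Nullary.Decidable using (⌊_⌋; toWitness; fromWitness; map′)
open import Relation.Nullary.Decidable.Core using (Dec; yes; no; _×-dec_; _⊎-dec_; ¬?)
open import Relation.Nullary.Negation.Core using (¬_; contradiction)
import Algebra.Properties.AbelianGroup ℤ.+-0-abelianGroup as ℤGroup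
open import Algebra.Properties.CommutativeSemigroup +-commutativeSemigroup using (interchange; xy∙z≈xz∙y)
import Algebra.Properties.Group ℚ.+-0-group as ℚGroup

-- Both directions build an `ArcSystem` and prove `hook` for it: for [i,j] in E and i ≤ k < j some
-- arc of level k either ends at j and starts no earlier than i, or starts at i and ends no later
-- than j. Such arcs are entries of d^{i,j}, which makes its inequality tight. Given w, both `hook`
-- and E ∈ R_p come from one count: the nested matching joins a nonmember i to a member j when
-- `H k i j` equals k + 1. Only one element is added in passing from w{1,...,k} to w{1,...,k+1}, so
-- `H k i j` - k never grows with k and drops by at most one per step; intermediate values do the
-- rest. Given E, no such count is available. The greedy choice makes `hook` hold by construction,
-- while closure under intersection yields the antichain and, through a descent, the growth of the
-- subsets. E consists of the arcs of all levels, also those with a_k = 0, so singular weights need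
-- no separate treatment.

m≤1+n∧m≢1+n⇒m≤n : ∀ {m n} → m ≤ suc n → m ≢ suc n → m ≤ n
m≤1+n∧m≢1+n⇒m≤n m≤ m≢ = ≤-pred (≤∧≢⇒< m≤ m≢)

𝟙 : ∀ {p} {P : Set p} → Dec P → ℕ
𝟙 (yes _) = 1
𝟙 (no  _) = 0

𝟙-yes : ∀ {p} {P : Set p} (d : Dec P) → P → 𝟙 d ≡ 1
𝟙-yes (yes _) _ = refl
𝟙-yes (no ¬p) p = contradiction p ¬p

𝟙-no : ∀ {p} {P : Set p} (d : Dec P) → ¬ P → 𝟙 d ≡ 0
𝟙-no (yes p) ¬p = contradiction p ¬p
𝟙-no (no _)  _  = refl

𝟙≤1 : ∀ {p} {P : Set p} (d : Dec P) → 𝟙 d ≤ 1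
𝟙≤1 (yes _) = ≤-refl
𝟙≤1 (no _)  = z≤n

-- Finite sums in a commutative semiring

module Summation (R : CommutativeSemiring 0ℓ 0ℓ) where
  private module R = CommutativeSemiring R
  open R using (_≈_; 0#) renaming (Carrier to A; _+_ to _⊞_; _*_ to _⊠_; refl to ≈-refl; sym to ≈-sym; trans to ≈-trans)
  open import Algebra.Properties.CommutativeSemigroup R.+-commutativeSemigroup using () renaming (interchange to ⊞-interchange)
  open import Relation.Binary.Reasoning.Setoid R.setoid

  -- ∑ n f is f 1 + ... + f n.
  ∑ : ℕ → (ℕ → A) → A
  ∑ zero    f = 0#
  ∑ (suc n) f = ∑ n f ⊞ f (suc n)

  ∑-cong : ∀ n {f g} → (∀ t → 1 ≤ t → t ≤ n → f t ≈ g t) → ∑ n f ≈ ∑ n g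
  ∑-cong zero    f≈g = ≈-refl
  ∑-cong (suc n) f≈g = R.+-cong (∑-cong n λ t 1≤t t≤n → f≈g t 1≤t (m≤n⇒m≤1+n t≤n)) (f≈g (suc n) (s≤s z≤n) ≤-refl)

  ∑-zero : ∀ n {f} → (∀ t → 1 ≤ t → t ≤ n → f t ≈ 0#) → ∑ n f ≈ 0#
  ∑-zero zero    f≈0 = ≈-refl
  ∑-zero (suc n) f≈0 = ≈-trans
    (R.+-cong (∑-zero n λ t 1≤t t≤n → f≈0 t 1≤t (m≤n⇒m≤1+n t≤n)) (f≈0 (suc n) (s≤s z≤n) ≤-refl))
    (R.+-identityˡ 0#)

  ∑-single : ∀ n {f} x → 1 ≤ x → x ≤ n → (∀ t → 1 ≤ t → t ≤ n → t ≢ x → f t ≈ 0#) → ∑ n f ≈ f x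
  ∑-single zero    x 1≤x x≤0 _ = contradiction (≤-trans 1≤x x≤0) λ ()
  ∑-single (suc n) x 1≤x x≤n f≈0 with x ≟ suc n
  ... | yes refl = ≈-trans
    (R.+-congʳ (∑-zero n λ t 1≤t t≤n → f≈0 t 1≤t (m≤n⇒m≤1+n t≤n) (<⇒≢ (s≤s t≤n))))
    (R.+-identityˡ _)
  ... | no x≢ = ≈-trans
    (R.+-cong (∑-single n x 1≤x (m≤1+n∧m≢1+n⇒m≤n x≤n x≢) λ t 1≤t t≤n → f≈0 t 1≤t (m≤n⇒m≤1+n t≤n))
            (f≈0 (suc n) (s≤s z≤n) ≤-refl (x≢ ∘ sym)))
    (R.+-identityʳ _)

  ∑-+ : ∀ n f g → ∑ n (λ t → f t ⊞ g t) ≈ ∑ n f ⊞ ∑ n g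
  ∑-+ zero    f g = ≈-sym (R.+-identityˡ 0#)
  ∑-+ (suc n) f g = ≈-trans (R.+-congʳ (∑-+ n f g)) (⊞-interchange _ _ _ _)

  ∑-*ˡ : ∀ n c f → ∑ n (λ t → c ⊠ f t) ≈ c ⊠ ∑ n f
  ∑-*ˡ zero    c f = ≈-sym (R.zeroʳ c)
  ∑-*ˡ (suc n) c f = ≈-trans (R.+-congʳ (∑-*ˡ n c f)) (≈-sym (R.distribˡ c _ _))

  ∑-*ʳ : ∀ n c f → ∑ n (λ t → f t ⊠ c) ≈ ∑ n f ⊠ c
  ∑-*ʳ zero    c f = ≈-sym (R.zeroˡ c)
  ∑-*ʳ (suc n) c f = ≈-trans (R.+-congʳ (∑-*ʳ n c f)) (≈-sym (R.distribʳ c _ _))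

  ∑-swap : ∀ m n (f : ℕ → ℕ → A) → ∑ m (λ i → ∑ n (f i)) ≈ ∑ n (λ j → ∑ m (λ i → f i j))
  ∑-swap zero    n f = ≈-sym (∑-zero n λ _ _ _ → ≈-refl)
  ∑-swap (suc m) n f = ≈-trans (R.+-congʳ (∑-swap m n f)) (≈-sym (∑-+ n _ _))

  sumR-snoc : ∀ f b l → sumR _⊞_ 0# f b (suc l) ≈ sumR _⊞_ 0# f b l ⊞ f (b + l)
  sumR-snoc f b zero    = ≈-trans (R.+-comm _ _) (R.+-congˡ (R.reflexive (cong f (sym (+-identityʳ b)))))
  sumR-snoc f b (suc l) = begin
    f b ⊞ sumR _⊞_ 0# f (suc b) (suc l)             ≈⟨ R.+-congˡ (sumR-snoc f (suc b) l) ⟩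
    f b ⊞ (sumR _⊞_ 0# f (suc b) l ⊞ f (suc b + l)) ≈⟨ R.+-assoc _ _ _ ⟨
    sumR _⊞_ 0# f b (suc l) ⊞ f (suc b + l)         ≈⟨ R.+-congˡ (R.reflexive (cong f (+-suc b l))) ⟨
    sumR _⊞_ 0# f b (suc l) ⊞ f (b + suc l)         ∎

  ∑-split : ∀ f b l → ∑ (b + l) f ≈ ∑ b f ⊞ sumR _⊞_ 0# f (suc b) l
  ∑-split f b zero    = ≈-trans (R.reflexive (cong (λ n → ∑ n f) (+-identityʳ b))) (≈-sym (R.+-identityʳ _))
  ∑-split f b (suc l) = begin
    ∑ (b + suc l) f                                       ≡⟨ cong (λ n → ∑ n f) (+-suc b l) ⟩
    ∑ (b + l) f ⊞ f (suc b + l)                           ≈⟨ R.+-congʳ (∑-split f b l) ⟩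
    (∑ b f ⊞ sumR _⊞_ 0# f (suc b) l) ⊞ f (suc b + l)     ≈⟨ R.+-assoc _ _ _ ⟩
    ∑ b f ⊞ (sumR _⊞_ 0# f (suc b) l ⊞ f (suc b + l))     ≈⟨ R.+-congˡ (sumR-snoc f (suc b) l) ⟨
    ∑ b f ⊞ sumR _⊞_ 0# f (suc b) (suc l)                 ∎

  sumR≈∑ : ∀ f n → sumR _⊞_ 0# f 1 n ≈ ∑ n f
  sumR≈∑ f n = ≈-sym (≈-trans (∑-split f 0 n) (R.+-identityˡ _))

  sumR-cong : ∀ {f g} b l → (∀ t → b ≤ t → t < b + l → f t ≈ g t) → sumR _⊞_ 0# f b l ≈ sumR _⊞_ 0# g b l
  sumR-cong b zero    f≈g = ≈-refl
  sumR-cong b (suc l) f≈g = R.+-cong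
    (f≈g b ≤-refl (m<m+n b (s≤s z≤n)))
    (sumR-cong (suc b) l λ t b<t t< → f≈g t (<⇒≤ b<t) (subst (t <_) (sym (+-suc b l)) t<))

  ∑-initial-zeros : ∀ f b n → b ≤ n → (∀ t → 1 ≤ t → t ≤ b → f t ≈ 0#) → sumR _⊞_ 0# f (suc b) (n ∸ b) ≈ ∑ n f
  ∑-initial-zeros f b n b≤n f≈0 = ≈-sym (begin
    ∑ n f                                   ≡⟨ cong (λ n → ∑ n f) (m+[n∸m]≡n b≤n) ⟨
    ∑ (b + (n ∸ b)) f                       ≈⟨ ∑-split f b (n ∸ b) ⟩
    ∑ b f ⊞ sumR _⊞_ 0# f (suc b) (n ∸ b)   ≈⟨ R.+-congʳ (∑-zero b f≈0) ⟩
    0# ⊞ sumR _⊞_ 0# f (suc b) (n ∸ b)      ≈⟨ R.+-identityˡ _ ⟩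
    sumR _⊞_ 0# f (suc b) (n ∸ b)           ∎)

  ∑-final-zeros : ∀ f {m n} → m ≤ n → (∀ t → m < t → t ≤ n → f t ≈ 0#) → ∑ n f ≈ ∑ m f
  ∑-final-zeros f {m} {zero} m≤n f≈0 with refl ← n≤0⇒n≡0 m≤n = ≈-refl
  ∑-final-zeros f {m} {suc n} m≤n f≈0 with m ≟ suc n
  ... | yes refl = ≈-refl
  ... | no m≢ = ≈-trans
    (R.+-cong (∑-final-zeros f (m≤1+n∧m≢1+n⇒m≤n m≤n m≢) λ t m<t t≤n → f≈0 t m<t (m≤n⇒m≤1+n t≤n))
            (f≈0 (suc n) (≤∧≢⇒< m≤n m≢) ≤-refl))
    (R.+-identityʳ _)

open Summation +-*-commutativeSemiring
module ℤ∑ = Summation (CommutativeRing.commutativeSemiring ℤ.+-*-commutativeRing)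

pos-∑ : ∀ n f → ℤ.+ ∑ n f ≡ ℤ∑.∑ n (λ t → ℤ.+ f t)
pos-∑ zero    f = refl
pos-∑ (suc n) f = cong (ℤ._+ (ℤ.+ f (suc n))) (pos-∑ n f)

∑-mono-≤ : ∀ n {f g} → (∀ t → 1 ≤ t → t ≤ n → f t ≤ g t) → ∑ n f ≤ ∑ n g
∑-mono-≤ zero    f≤g = z≤n
∑-mono-≤ (suc n) f≤g = +-mono-≤ (∑-mono-≤ n λ t 1≤t t≤n → f≤g t 1≤t (m≤n⇒m≤1+n t≤n)) (f≤g (suc n) (s≤s z≤n) ≤-refl)

-- A discrete intermediate value theorem. It is applied to an endpoint at a fixed level and to the
-- level at fixed endpoints.
crossing : ∀ {P : ℕ → Set} → (∀ t → Dec (P t)) → ∀ {b} e → b ≤ e → P b → ¬ P e →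
           ∃[ t ] b ≤ t × t < e × P t × ¬ P (suc t)
crossing P? {b} zero b≤0 Pb ¬Pe with refl ← n≤0⇒n≡0 b≤0 = contradiction Pb ¬Pe
crossing {P} P? {b} (suc e) b≤ Pb ¬Pe = helper (P? e)
  where
  b≤e : b ≤ e
  b≤e = m≤1+n∧m≢1+n⇒m≤n b≤ λ { refl → ¬Pe Pb }
  helper : Dec (P e) → ∃[ t ] b ≤ t × t < suc e × P t × ¬ P (suc t)
  helper (yes Pe)  = e , b≤e , ≤-refl , Pe , ¬Pe
  helper (no ¬Pe′) with t , b≤t , t<e , Pt , ¬Pst ← crossing P? e b≤e Pb ¬Pe′ =
    t , b≤t , m≤n⇒m≤1+n t<e , Pt , ¬Pst

-- Dyck paths and arcs

∑-window : ∀ f b l N → b ≤ l → l ≤ N → (∀ k → 1 ≤ k → k ≤ N → ¬ (b < k × k ≤ l) → f k ≡ 0) →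
           ∑ N f ≡ sumR _+_ 0 f (suc b) (l ∸ b)
∑-window f b l N b≤l l≤N f≡0 = trans
  (∑-final-zeros f l≤N λ k l<k k≤N → f≡0 k (≤-trans (s≤s z≤n) l<k) k≤N λ (_ , k≤l) → <⇒≱ l<k k≤l)
  (sym (∑-initial-zeros f b l b≤l λ k 1≤k k≤b → f≡0 k 1≤k (≤-trans k≤b (≤-trans b≤l l≤N)) λ (b<k , _) → <⇒≱ b<k k≤b))

sumR-mono-≤ : ∀ {f g} b l → (∀ t → f t ≤ g t) → sumR _+_ 0 f b l ≤ sumR _+_ 0 g b l
sumR-mono-≤ b zero    f≤g = z≤n
sumR-mono-≤ b (suc l) f≤g = +-mono-≤ (f≤g b) (sumR-mono-≤ (suc b) l f≤g)

pathSum : (ℕ → ℕ → ℕ) → List (ℕ × ℕ) → ℕ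
pathSum f = foldr (λ p acc → f (proj₁ p) (proj₂ p) + acc) 0

pathSum-∑ : ∀ N (a : ℕ → ℕ) (f : ℕ → ℕ → ℕ → ℕ) d →
            pathSum (λ i j → ∑ N λ k → a k * f k i j) d ≡ ∑ N λ k → a k * pathSum (f k) d
pathSum-∑ N a f []            = sym (∑-zero N λ k _ _ → *-zeroʳ (a k))
pathSum-∑ N a f ((i , j) ∷ d) = begin
  ∑ N (λ k → a k * f k i j) + pathSum (λ i j → ∑ N λ k → a k * f k i j) d  ≡⟨ cong (_ +_) (pathSum-∑ N a f d) ⟩
  ∑ N (λ k → a k * f k i j) + ∑ N (λ k → a k * pathSum (f k) d)           ≡⟨ ∑-+ N _ _ ⟨
  ∑ N (λ k → a k * f k i j + a k * pathSum (f k) d)                       ≡⟨ ∑-cong N (λ k _ _ → *-distribˡ-+ (a k) _ _) ⟨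
  ∑ N (λ k → a k * (f k i j + pathSum (f k) d))                           ∎
  where open ≡-Reasoning

∈⇒≤pathSum : ∀ f {i j d} → (i , j) ∈ d → f i j ≤ pathSum f d
∈⇒≤pathSum f {d = (i , j) ∷ d} (here refl) = m≤m+n (f i j) _
∈⇒≤pathSum f {d = (i , j) ∷ d} (there p∈d) = ≤-trans (∈⇒≤pathSum f p∈d) (m≤n+m _ (f i j))

-- The strict growth of the coordinate sum is recorded so that no entry of a path can recur.
chain-increasing : ∀ i j d → Chain ((i , j) ∷ d) →
                   All (λ q → i ≤ proj₁ q × j ≤ proj₂ q × i + j < proj₁ q + proj₂ q) d
chain-increasing i j [] _ = []
chain-increasing i j ((.(suc i) , .j) ∷ d) (inj₁ (refl , refl) , ch) =
  (n≤1+n i , ≤-refl , ≤-refl) ∷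
  All.map (λ (i< , j≤ , +<) → <⇒≤ i< , j≤ , <-trans ≤-refl +<) (chain-increasing (suc i) j d ch)
chain-increasing i j ((.i , .(suc j)) ∷ d) (inj₂ (refl , refl) , ch) =
  (≤-refl , n≤1+n j , ≤-reflexive (sym (+-suc i j))) ∷
  All.map (λ (i≤ , j< , +<) → i≤ , <⇒≤ j< , <-trans (≤-reflexive (sym (+-suc i j))) +<) (chain-increasing i (suc j) d ch)

chain-tail : ∀ p d → Chain (p ∷ d) → Chain d
chain-tail p []      _        = _
chain-tail p (_ ∷ _) (_ , ch) = ch

-- Coordinates only grow along a chain, and ending on the diagonal determines both coordinates of
-- the last entry.
chain-below-end : ∀ d → Chain d → EndsDiag d → All (λ q → proj₁ q ≤ lastI d × proj₂ q ≤ suc (lastI d)) d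
chain-below-end (p ∷ []) _ refl = (≤-refl , ≤-refl) ∷ []
chain-below-end (p ∷ q ∷ d) ch@(_ , ch′) end =
  extend (chain-increasing (proj₁ p) (proj₂ p) (q ∷ d) ch) (chain-below-end (q ∷ d) ch′ end)
  where
  extend : ∀ {m} → All (λ q → proj₁ p ≤ proj₁ q × proj₂ p ≤ proj₂ q × proj₁ p + proj₂ p < proj₁ q + proj₂ q) (q ∷ d) →
           All (λ q → proj₁ q ≤ m × proj₂ q ≤ suc m) (q ∷ d) → All (λ q → proj₁ q ≤ m × proj₂ q ≤ suc m) (p ∷ q ∷ d)
  extend ((i≤ , j≤ , _) ∷ _) bounded@((≤m , ≤1+m) ∷ _) = (≤-trans i≤ ≤m , ≤-trans j≤ ≤1+m) ∷ bounded

dyck-firstI : ∀ {n d} → IsDyck n d → 1 ≤ firstI d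
dyck-firstI {d = p ∷ d} ((1≤i , _) ∷ _ , _) = 1≤i

dyck-first≤last : ∀ {n d} → IsDyck n d → firstI d ≤ lastI d
dyck-first≤last {d = d@(_ ∷ _)} (_ , _ , end , ch) with (i≤ , _) ∷ _ ← chain-below-end d ch end = i≤

dyck-lastI : ∀ {n d} → IsDyck n d → lastI d < n
dyck-lastI (valid , _ , end , ch) = go _ valid end
  where
  go : ∀ {n} d → All (λ p → Valid n (proj₁ p) (proj₂ p)) d → EndsDiag d → lastI d < n
  go (p ∷ []) ((_ , i<j , j≤n) ∷ []) end = <-≤-trans i<j j≤n
  go (p ∷ q ∷ d) (_ ∷ v) end = go (q ∷ d) v end

dyck-first≤ : ∀ {n d} → IsDyck n d → All (λ q → firstI d ≤ proj₁ q) d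
dyck-first≤ {d = (i , j) ∷ d} (_ , _ , _ , ch) = ≤-refl ∷ All.map proj₁ (chain-increasing i j d ch)

-- The common output of the two constructions. `antichain` refers to the product order on pairs, the
-- order in which Dyck paths ascend.
record ArcSystem (n : ℕ) : Set₁ where
  field
    Arc       : ℕ → ℕ → ℕ → Set
    arc?      : ∀ k i j → Dec (Arc k i j)
    bounds    : ∀ {k i j} → Arc k i j → 1 ≤ i × i ≤ k × k < j × j ≤ n
    antichain : ∀ {k i j i′ j′} → Arc k i j → Arc k i′ j′ → i ≤ i′ → j ≤ j′ → i ≡ i′ × j ≡ j′

  arcs : ℕ → ℕ → ℕ → ℕ
  arcs k i j = 𝟙 (arc? k i j)

  point : (ℕ → ℕ) → ℕ → ℕ → ℕ
  point a i j = ∑ (n ∸ 1) λ k → a k * arcs k i j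

  unique-right : ∀ {k i j j′} → Arc k i j → Arc k i j′ → j ≡ j′
  unique-right {j = j} {j′} A A′ with ≤-total j j′
  ... | inj₁ j≤j′ = proj₂ (antichain A A′ ≤-refl j≤j′)
  ... | inj₂ j′≤j = sym (proj₂ (antichain A′ A ≤-refl j′≤j))

  unique-left : ∀ {k i i′ j} → Arc k i j → Arc k i′ j → i ≡ i′
  unique-left {i = i} {i′} A A′ with ≤-total i i′
  ... | inj₁ i≤i′ = proj₁ (antichain A A′ i≤i′ ≤-refl)
  ... | inj₂ i′≤i = sym (proj₁ (antichain A′ A i′≤i ≤-refl))

  -- χ is the indicator at m of the k-subset obtained from {1,…,k} by
  -- exchanging the left ends of the arcs at level k for their right ends.
  record Exchanged (k m χ : ℕ) : Set where
    field
      low  : m ≤ k → (χ ≡ 1 × (∀ j → ¬ Arc k m j)) ⊎ (χ ≡ 0 × ∃[ j ] Arc k m j)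
      high : k < m → (χ ≡ 0 × (∀ i → ¬ Arc k i m)) ⊎ (χ ≡ 1 × ∃[ i ] Arc k i m)

  -- A number up to `k` is either kept or starts exactly one arc; a larger one is either absent or
  -- ends exactly one arc. The arc counts stand on opposite sides to avoid subtraction.
  balance : ∀ {k m χ} → Exchanged k m χ →
            𝟙 (m ≤? k) + ∑ n (λ i → arcs k i m) ≡ χ + ∑ n (arcs k m)
  balance {k} {m} {χ} ex with m ≤? k
  ... | yes m≤k = trans (cong suc (∑-zero n λ i _ _ → 𝟙-no (arc? k i m) λ A → <⇒≱ (proj₁ (proj₂ (proj₂ (bounds A)))) m≤k)) (lemma (Exchanged.low ex m≤k))
    where
    lemma : (χ ≡ 1 × (∀ j → ¬ Arc k m j)) ⊎ (χ ≡ 0 × ∃[ j ] Arc k m j) → 1 ≡ χ + ∑ n (arcs k m)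
    lemma (inj₁ (refl , none)) = sym (cong suc (∑-zero n λ j _ _ → 𝟙-no (arc? k m j) (none j)))
    lemma (inj₂ (refl , j , A)) with 1≤m , m≤k , k<j , j≤n ← bounds A = sym (trans
      (∑-single n j (≤-trans (s≤s z≤n) k<j) j≤n λ t _ _ t≢j → 𝟙-no (arc? k m t) λ A′ → t≢j (unique-right A′ A))
      (𝟙-yes (arc? k m j) A))
  ... | no m≰k = trans (lemma (Exchanged.high ex (≰⇒> m≰k)))
    (cong (χ +_) (sym (∑-zero n λ j _ _ → 𝟙-no (arc? k m j) λ A → m≰k (proj₁ (proj₂ (bounds A))))))
    where
    lemma : (χ ≡ 0 × (∀ i → ¬ Arc k i m)) ⊎ (χ ≡ 1 × ∃[ i ] Arc k i m) → ∑ n (λ i → arcs k i m) ≡ χ + 0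
    lemma (inj₁ (refl , none)) = ∑-zero n λ i _ _ → 𝟙-no (arc? k i m) (none i)
    lemma (inj₂ (refl , i , A)) with 1≤i , i≤k , k<m , m≤n ← bounds A = trans
      (∑-single n i 1≤i (≤-trans i≤k (≤-trans (<⇒≤ k<m) m≤n)) λ t _ _ t≢i → 𝟙-no (arc? k t m) λ A′ → t≢i (unique-left A′ A))
      (𝟙-yes (arc? k i m) A)

  pathSum-none : ∀ k {d} → All (λ p → ¬ Arc k (proj₁ p) (proj₂ p)) d → pathSum (arcs k) d ≡ 0
  pathSum-none k [] = refl
  pathSum-none k (¬A ∷ none) = cong₂ _+_ (𝟙-no (arc? k _ _) ¬A) (pathSum-none k none)

  pathSum-arcs≤1 : ∀ k d → Chain d → pathSum (arcs k) d ≤ 1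
  pathSum-arcs≤1 k [] _ = z≤n
  pathSum-arcs≤1 k ((i , j) ∷ d) ch with arc? k i j
  ... | no _  = pathSum-arcs≤1 k d (chain-tail (i , j) d ch)
  ... | yes A = s≤s (≤-reflexive (pathSum-none k (All.map later (chain-increasing i j d ch))))
    where
    later : ∀ {q} → i ≤ proj₁ q × j ≤ proj₂ q × i + j < proj₁ q + proj₂ q → ¬ Arc k (proj₁ q) (proj₂ q)
    later (i≤ , j≤ , +<) A′ with refl , refl ← antichain A A′ i≤ j≤ = <-irrefl refl +<

  -- An arc of level k on the path satisfies i_1 ≤ i ≤ k < j ≤ i_N + 1, so a_k is one of the
  -- summands of `M a d`.
  pathSum-outside : ∀ k {d} → IsDyck n d → ¬ (firstI d ≤ k × k ≤ lastI d) → pathSum (arcs k) d ≡ 0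
  pathSum-outside k {d} dyck@(_ , _ , end , ch) outside =
    pathSum-none k (All.zipWith absurd (dyck-first≤ dyck , chain-below-end d ch end))
    where
    absurd : ∀ {q} → (firstI d ≤ proj₁ q) × (proj₁ q ≤ lastI d × proj₂ q ≤ suc (lastI d)) → ¬ Arc k (proj₁ q) (proj₂ q)
    absurd (f≤ , _ , j≤) A with _ , i≤k , k<j , _ ← bounds A = outside (≤-trans f≤ i≤k , ≤-pred (≤-trans k<j j≤))

  module _ (a : ℕ → ℕ) where

    private
      -- With `firstI d` in the form `suc b`, the number of summands `suc l ∸ suc b` in `M a d`
      -- reduces to `l ∸ b`.
      restrict : ∀ {d} → IsDyck n d → ∀ b → firstI d ≡ suc b → pathSum (point a) d ≡ sumR _+_ 0 (λ k → a k * pathSum (arcs k) d) (suc b) (lastI d ∸ b)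
      restrict {d} dyck b eq = trans (pathSum-∑ (n ∸ 1) a arcs d)
        (∑-window _ b (lastI d) (n ∸ 1) (≤-trans (n≤1+n b) (subst (_≤ lastI d) eq (dyck-first≤last dyck))) (∸-monoˡ-≤ 1 (dyck-lastI dyck)) λ k _ _ out →
          trans (cong (a k *_) (pathSum-outside k dyck λ (f≤ , ≤l) → out (subst (_≤ k) eq f≤ , ≤l))) (*-zeroʳ (a k)))

    pathSum-point≤M : ∀ {d} → IsDyck n d → pathSum (point a) d ≤ M a d
    pathSum-point≤M {d} dyck with firstI d | dyck-firstI dyck | restrict dyck
    ... | suc b | _ | r = ≤-trans (≤-reflexive (r b refl))
      (sumR-mono-≤ (suc b) (lastI d ∸ b) λ k → ≤-trans (*-monoʳ-≤ (a k) (pathSum-arcs≤1 k d (proj₂ (proj₂ (proj₂ dyck))))) (≤-reflexive (*-identityʳ (a k))))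

    pathSum-point≡M : ∀ {d} → IsDyck n d → (∀ k → firstI d ≤ k → k ≤ lastI d → ∃[ i ] ∃[ j ] (i , j) ∈ d × Arc k i j) →
                      pathSum (point a) d ≡ M a d
    pathSum-point≡M {d} dyck hit with firstI d | dyck-firstI dyck | restrict dyck | dyck-first≤last dyck
    ... | suc b | _ | r | f≤l = trans (r b refl)
      (sumR-cong (suc b) (lastI d ∸ b) λ k b<k k< → trans (cong (a k *_) (one k b<k (≤-pred (subst (k <_) (cong suc (m+[n∸m]≡n (<⇒≤ f≤l))) k<)))) (*-identityʳ (a k)))
      where
      one : ∀ k → suc b ≤ k → k ≤ lastI d → pathSum (arcs k) d ≡ 1
      one k b<k k≤l with i , j , p∈d , A ← hit k b<k k≤l =
        ≤-antisym (pathSum-arcs≤1 k d (proj₂ (proj₂ (proj₂ dyck))))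
                  (subst (_≤ pathSum (arcs k) d) (𝟙-yes (arc? k i j) A) (∈⇒≤pathSum (arcs k) p∈d))

-- The points x(E)

range-All : ∀ {P : ℕ → Set} b l → (∀ t → b ≤ t → t < b + l → P t) → All P (range b l)
range-All b zero    f = []
range-All b (suc l) f =
  f b ≤-refl (m<m+n b (s≤s z≤n)) ∷
  range-All (suc b) l λ t b<t t< → f t (<⇒≤ b<t) (subst (t <_) (sym (+-suc b l)) t<)

∈-range : ∀ {t} b l → b ≤ t → t < b + l → t ∈ range b l
∈-range {t} b zero    b≤t t< = contradiction (subst (t <_) (+-identityʳ b) t<) (≤⇒≯ b≤t)
∈-range {t} b (suc l) b≤t t< with b ≟ t
... | yes b≡t = here (sym b≡t)
... | no  b≢t = there (∈-range (suc b) l (≤∧≢⇒< b≤t b≢t) (subst (t <_) (+-suc b l) t<))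

range-snoc : ∀ b l → range b (suc l) ≡ range b l ++ (b + l) ∷ []
range-snoc b zero    = cong (_∷ []) (sym (+-identityʳ b))
range-snoc b (suc l) = cong (b ∷_) (trans (range-snoc (suc b) l) (cong (λ t → range (suc b) l ++ t ∷ []) (sym (+-suc b l))))

leg-chain : ∀ i j l → Chain ((i , j) ∷ map (_, j) (range (suc i) l))
leg-chain i j zero    = _
leg-chain i j (suc l) = inj₁ (refl , refl) , leg-chain (suc i) j l

leg-end : ∀ i j l → j ≡ suc i + l → let d = (i , j) ∷ map (_, j) (range (suc i) l) in EndsDiag d × lastI d ≡ i + l
leg-end i j zero    j≡ = trans j≡ (cong suc (+-identityʳ i)) , sym (+-identityʳ i)
leg-end i j (suc l) j≡ with end , last ← leg-end (suc i) j l (trans j≡ (cong suc (+-suc i l))) = end , trans last (sym (+-suc i l))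

arm-chain : ∀ i j b l l′ → j ≡ b + l → Chain (map (i ,_) (range b (suc l)) ++ map (_, j) (range (suc i) l′))
arm-chain i j b zero    l′ j≡ with refl ← trans j≡ (+-identityʳ b) = leg-chain i j l′
arm-chain i j b (suc l) l′ j≡ = inj₂ (refl , refl) , arm-chain i j (suc b) l l′ (trans j≡ (+-suc b l))

arm-end : ∀ i j b l l′ → j ≡ b + l → j ≡ suc i + l′ →
          let d = map (i ,_) (range b (suc l)) ++ map (_, j) (range (suc i) l′) in EndsDiag d × lastI d ≡ i + l′
arm-end i j b zero    l′ j≡ j≡′ with refl ← trans j≡ (+-identityʳ b) = leg-end i j l′ j≡′
arm-end i j b (suc l) l′ j≡ j≡′ = arm-end i j (suc b) l l′ (trans j≡ (+-suc b l)) j≡′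

dpath-length : ∀ i l → suc (i + l) ∸ i ≡ suc l
dpath-length i l = trans (cong (_∸ i) (sym (+-suc i l))) (m+n∸m≡n i (suc l))

dpath≡ : ∀ i l → dpath i (suc (i + l)) ≡ map (i ,_) (range (suc i) (suc l)) ++ map (_, suc (i + l)) (range (suc i) l)
dpath≡ i l = cong₂ (λ r s → map (i ,_) (range (suc i) r) ++ map (_, suc (i + l)) (range (suc i) s)) (dpath-length i l) (m+n∸m≡n i l)

-- Naming the length turns the two truncated subtractions in `dpath` into `suc l` and `l`.
data Span (i : ℕ) : ℕ → Set where
  span : ∀ l → Span i (suc (i + l))

toSpan : ∀ {i j} → i < j → Span i j
toSpan {i} {j} i<j = subst (Span i) (m+[n∸m]≡n i<j) (span (j ∸ suc i))

dpath-dyck : ∀ {n i j} → Valid n i j → IsDyck n (dpath i j)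
dpath-dyck {n} {i} {j} (1≤i , i<j , j≤n) with span l ← toSpan i<j rewrite dpath≡ i l =
  All.++⁺
    (All.map⁺ (range-All (suc i) (suc l) λ t i<t t< → 1≤i , i<t , ≤-trans (≤-pred (subst (t <_) (cong suc (+-suc i l)) t<)) j≤n))
    (All.map⁺ (range-All (suc i) l λ t i<t t< → ≤-trans 1≤i (<⇒≤ i<t) , t< , j≤n)) ,
  refl , proj₁ (arm-end i _ (suc i) l l refl refl) , arm-chain i _ (suc i) l l refl

dpath-firstI : ∀ {i j} → i < j → firstI (dpath i j) ≡ i
dpath-firstI {i} i<j with span l ← toSpan i<j rewrite dpath≡ i l = refl

dpath-lastI : ∀ {i j} → i < j → lastI (dpath i j) ≡ j ∸ 1
dpath-lastI {i} i<j with span l ← toSpan i<j rewrite dpath≡ i l = proj₂ (arm-end i _ (suc i) l l refl refl)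

∈-arm : ∀ {i j j′} → i < j′ → j′ ≤ j → (i , j′) ∈ dpath i j
∈-arm {i} {j} {j′} i<j′ j′≤j with span l ← toSpan (<-≤-trans i<j′ j′≤j) rewrite dpath≡ i l =
  ∈-++⁺ˡ (∈-map⁺ (i ,_) (∈-range (suc i) (suc l) i<j′ (subst (j′ <_) (cong suc (sym (+-suc i l))) (s≤s j′≤j))))

∈-leg : ∀ {i i′ j} → i ≤ i′ → i′ < j → (i′ , j) ∈ dpath i j
∈-leg {i} {i′} {j} i≤i′ i′<j with i ≟ i′
... | yes refl = ∈-arm i′<j ≤-refl
... | no i≢i′ with i<i′ ← ≤∧≢⇒< i≤i′ i≢i′ with span l ← toSpan (≤-<-trans i≤i′ i′<j) rewrite dpath≡ i l =
  ∈-++⁺ʳ (map (i ,_) (range (suc i) (suc l))) (∈-map⁺ (_, suc (i + l)) (∈-range (suc i) l i<i′ i′<j))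

-- This isolates the longest segment on the path, the unknown for which `IsXE-unique` solves the
-- equation of the path.
dpath-corner : ∀ i l → dpath i (suc (i + l)) ≡
               map (i ,_) (range (suc i) l) ++ (i , suc (i + l)) ∷ map (_, suc (i + l)) (range (suc i) l)
dpath-corner i l = begin
  dpath i (suc (i + l))                                                 ≡⟨ dpath≡ i l ⟩
  map (i ,_) (range (suc i) (suc l)) ++ leg                             ≡⟨ cong (λ r → map (i ,_) r ++ leg) (range-snoc (suc i) l) ⟩
  map (i ,_) (range (suc i) l ++ suc (i + l) ∷ []) ++ leg               ≡⟨ cong (_++ leg) (map-++ (i ,_) (range (suc i) l) _) ⟩
  (map (i ,_) (range (suc i) l) ++ (i , suc (i + l)) ∷ []) ++ leg       ≡⟨ ++-assoc (map (i ,_) (range (suc i) l)) _ leg ⟩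
  map (i ,_) (range (suc i) l) ++ (i , suc (i + l)) ∷ leg               ∎
  where
  open ≡-Reasoning
  leg = map (_, suc (i + l)) (range (suc i) l)

-- Normalisation in `ℚ` is stuck on variables; in `ℚᵘ` the claim is an identity of integers.
ℕ→ℚ-+ : ∀ m n → ℕ→ℚ (m + n) ≡ ℕ→ℚ m ℚ.+ ℕ→ℚ n
ℕ→ℚ-+ m n = ℚ.toℚᵘ-injective (begin
  ℚ.toℚᵘ (ℕ→ℚ (m + n))                     ≈⟨ ℚ.toℚᵘ-fromℚᵘ (mkℚᵘ (ℤ.+ (m + n)) 0) ⟩
  mkℚᵘ (ℤ.+ (m + n)) 0                     ≈⟨ *≡* (cong (ℤ._* ℤ.1ℤ) (cong₂ ℤ._+_ (sym (ℤ.*-identityʳ (ℤ.+ m))) (sym (ℤ.*-identityʳ (ℤ.+ n))))) ⟩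
  mkℚᵘ (ℤ.+ m) 0 ℚᵘ.+ mkℚᵘ (ℤ.+ n) 0       ≈⟨ ℚᵘ.+-cong (ℚ.toℚᵘ-fromℚᵘ (mkℚᵘ (ℤ.+ m) 0)) (ℚ.toℚᵘ-fromℚᵘ (mkℚᵘ (ℤ.+ n) 0)) ⟨
  ℚ.toℚᵘ (ℕ→ℚ m) ℚᵘ.+ ℚ.toℚᵘ (ℕ→ℚ n)       ≈⟨ ℚ.toℚᵘ-homo-+ (ℕ→ℚ m) (ℕ→ℚ n) ⟨
  ℚ.toℚᵘ (ℕ→ℚ m ℚ.+ ℕ→ℚ n)                 ∎)
  where open ℚᵘ.≃-Reasoning

ℕ→ℚ-mono-≤ : ∀ {m n} → m ≤ n → ℕ→ℚ m ℚ.≤ ℕ→ℚ n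
ℕ→ℚ-mono-≤ {m} {n} m≤n = ℚ.toℚᵘ-cancel-≤ (begin
  ℚ.toℚᵘ (ℕ→ℚ m)   ≃⟨ ℚ.toℚᵘ-fromℚᵘ (mkℚᵘ (ℤ.+ m) 0) ⟩
  mkℚᵘ (ℤ.+ m) 0   ≤⟨ *≤* (ℤ.*-monoʳ-≤-nonNeg ℤ.1ℤ (ℤ.+≤+ m≤n)) ⟩
  mkℚᵘ (ℤ.+ n) 0   ≃⟨ ℚ.toℚᵘ-fromℚᵘ (mkℚᵘ (ℤ.+ n) 0) ⟨
  ℚ.toℚᵘ (ℕ→ℚ n)   ∎)
  where open ℚᵘ.≤-Reasoning

S-ℕ→ℚ : ∀ f d → S (λ i j → ℕ→ℚ (f i j)) d ≡ ℕ→ℚ (pathSum f d)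
S-ℕ→ℚ f []            = refl
S-ℕ→ℚ f ((i , j) ∷ d) = trans (cong (ℕ→ℚ (f i j) ℚ.+_) (S-ℕ→ℚ f d)) (sym (ℕ→ℚ-+ (f i j) _))

S-cong : ∀ {x y d} → All (λ p → x (proj₁ p) (proj₂ p) ≡ y (proj₁ p) (proj₂ p)) d → S x d ≡ S y d
S-cong []         = refl
S-cong (eq ∷ eqs) = cong₂ ℚ._+_ eq (S-cong eqs)

S-agree-corner : ∀ {y z : Pt} i j A B →
  All (λ p → y (proj₁ p) (proj₂ p) ≡ z (proj₁ p) (proj₂ p)) A →
  All (λ p → y (proj₁ p) (proj₂ p) ≡ z (proj₁ p) (proj₂ p)) B →
  S y (A ++ (i , j) ∷ B) ≡ S z (A ++ (i , j) ∷ B) → y i j ≡ z i j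
S-agree-corner {y} {z} i j [] B _ agree eq =
  ℚGroup.∙-cancelʳ (S y B) _ _ (trans eq (cong (z i j ℚ.+_) (sym (S-cong agree))))
S-agree-corner {y} {z} i j ((k , l) ∷ A) B (e ∷ es) agree eq =
  S-agree-corner i j A B es agree (ℚGroup.∙-cancelˡ (y k l) _ _ (trans eq (cong (ℚ._+ _) (sym e))))

-- The equations defining x(E) are triangular with respect to the length of segments.
IsXE-unique : ∀ {n a E y z} → IsXE n a E y → IsXE n a E z → y ≈[ n ] z
IsXE-unique {n} {a} {E} {y} {z} (y0 , yE) (z0 , zE) i j v = go i j v (<-wellFounded (j ∸ i))
  where
  go : ∀ i j → Valid n i j → Acc _<_ (j ∸ i) → y i j ≡ z i j
  go i j v@(1≤i , i<j , j≤n) (acc rec) with T? (E i j)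
  ... | no ∉E = trans (y0 i j v ∉E) (sym (z0 i j v ∉E))
  ... | yes ∈E with sums≡ ← trans (yE i j v ∈E) (sym (zE i j v ∈E)) with span l ← toSpan i<j =
    S-agree-corner {y} {z} i (suc (i + l)) (map (i ,_) (range (suc i) l)) (map (_, suc (i + l)) (range (suc i) l))
      (All.map⁺ (range-All (suc i) l λ t i<t t< → go i t (1≤i , i<t , ≤-trans (<⇒≤ t<) j≤n) (rec (∸-monoˡ-< t< (<⇒≤ i<t)))))
      (All.map⁺ (range-All (suc i) l λ t i<t t< → go t (suc (i + l)) (≤-trans 1≤i (<⇒≤ i<t) , t< , j≤n) (rec (∸-monoʳ-< i<t (<⇒≤ t<)))))
      (subst (λ d → S y d ≡ S z d) (dpath-corner i l) sums≡)

S-combination : ∀ p q y z d → S (λ i j → p ℚ.* y i j ℚ.+ q ℚ.* z i j) d ≡ p ℚ.* S y d ℚ.+ q ℚ.* S z d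
S-combination p q y z [] = sym (cong₂ ℚ._+_ (ℚ.*-zeroʳ p) (ℚ.*-zeroʳ q))
S-combination p q y z ((i , j) ∷ d) = trans (cong ((p ℚ.* y i j ℚ.+ q ℚ.* z i j) ℚ.+_) (S-combination p q y z d))
  (solve 6 (λ p q u v U V → (p :* u :+ q :* v) :+ (p :* U :+ q :* V) := p :* (u :+ U) :+ q :* (v :+ V)) refl p q (y i j) (z i j) (S y d) (S z d))
  where open +-*-Solver

M-dpath : ∀ a {i j} → i < j → M a (dpath i j) ≡ sumℕ a i (j ∸ 1)
M-dpath a i<j = cong₂ (sumℕ a) (dpath-firstI i<j) (dpath-lastI i<j)

convex-max : ∀ {p q u v m} → 0ℚ ℚ.< p → 0ℚ ℚ.< q → p ℚ.+ q ≡ 1ℚ → u ℚ.≤ m → v ℚ.≤ m →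
             p ℚ.* u ℚ.+ q ℚ.* v ≡ m → u ≡ m
convex-max {p} {q} {u} {v} {m} 0<p 0<q p+q≡1 u≤m v≤m eq = ℚ.≤-antisym u≤m (ℚ.≮⇒≥ λ u<m → ℚ.<-irrefl eq (begin-strict
  p ℚ.* u ℚ.+ q ℚ.* v   <⟨ ℚ.+-mono-<-≤ (ℚ.*-monoʳ-<-pos p {{ℚ.positive 0<p}} u<m) (ℚ.*-monoˡ-≤-nonNeg q {{ℚ.pos⇒nonNeg q {{ℚ.positive 0<q}}}} v≤m) ⟩
  p ℚ.* m ℚ.+ q ℚ.* m   ≡⟨ ℚ.*-distribʳ-+ m p q ⟨
  (p ℚ.+ q) ℚ.* m       ≡⟨ cong (ℚ._* m) p+q≡1 ⟩
  1ℚ ℚ.* m              ≡⟨ ℚ.*-identityˡ m ⟩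
  m                     ∎))
  where open ℚ.≤-Reasoning

-- The case of maximum 0 of `convex-max`, after a change of sign.
convex-zero : ∀ {p q u v} → 0ℚ ℚ.< p → 0ℚ ℚ.< q → p ℚ.+ q ≡ 1ℚ → 0ℚ ℚ.≤ u → 0ℚ ℚ.≤ v →
              p ℚ.* u ℚ.+ q ℚ.* v ≡ 0ℚ → u ≡ 0ℚ
convex-zero {p} {q} {u} {v} 0<p 0<q p+q≡1 0≤u 0≤v eq = ℚ.neg-injective
  (convex-max 0<p 0<q p+q≡1 (ℚ.neg-antimono-≤ 0≤u) (ℚ.neg-antimono-≤ 0≤v)
    (trans (solve 4 (λ p q u v → p :* (:- u) :+ q :* (:- v) := :- (p :* u :+ q :* v)) refl p q u v) (cong ℚ.-_ eq)))
  where open +-*-Solver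

-- Each equation of x(E) is an inequality of P_λ turned into an equality, so it cuts out a face; a
-- segment in P_λ with an interior point on a face lies in that face.
IsXE-face : ∀ {n a E x y z p q} → IsXE n a E x → InP n a y → InP n a z → 0ℚ ℚ.< p → 0ℚ ℚ.< q → p ℚ.+ q ≡ 1ℚ →
            x ≈[ n ] (λ i j → p ℚ.* y i j ℚ.+ q ℚ.* z i j) → IsXE n a E y
IsXE-face {n} {a} {E} {x} {y} {z} {p} {q} (x0 , xE) (0≤y , y≤M) (0≤z , z≤M) 0<p 0<q p+q≡1 x≈ =
  (λ i j v ∉E → convex-zero 0<p 0<q p+q≡1 (0≤y i j v) (0≤z i j v) (trans (sym (x≈ i j v)) (x0 i j v ∉E))) ,
  λ i j v@(_ , i<j , _) ∈E → let dyck = dpath-dyck v in convex-max 0<p 0<q p+q≡1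
    (subst (λ m → S y (dpath i j) ℚ.≤ ℕ→ℚ m) (M-dpath a i<j) (y≤M _ dyck))
    (subst (λ m → S z (dpath i j) ℚ.≤ ℕ→ℚ m) (M-dpath a i<j) (z≤M _ dyck))
    (trans (sym (S-combination p q y z (dpath i j)))
      (trans (sym (S-cong (All.map (λ {q} v → x≈ (proj₁ q) (proj₂ q) v) (proj₁ dyck)))) (xE i j v ∈E)))

InP∧IsXE⇒IsVertex : ∀ {n a E x} → InP n a x → IsXE n a E x → IsVertex n a x
InP∧IsXE⇒IsVertex x∈P xE = x∈P , λ y z t y∈P z∈P 0<t t<1 x≈ →
  let 0<1-t = subst (ℚ._< 1ℚ ℚ.- t) (ℚ.+-inverseʳ t) (ℚ.+-monoˡ-< (ℚ.- t) t<1)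
      t+[1-t]≡1 = solve 2 (λ t o → t :+ (o :- t) := o) refl t 1ℚ
  in IsXE-unique
    (IsXE-face xE y∈P z∈P 0<t 0<1-t t+[1-t]≡1 x≈)
    (IsXE-face xE z∈P y∈P 0<1-t 0<t (trans (ℚ.+-comm (1ℚ ℚ.- t) t) t+[1-t]≡1)
      λ i j v → trans (x≈ i j v) (ℚ.+-comm (t ℚ.* y i j) _))
  where open +-*-Solver

-- The lattice point of an arc system

module _ {n : ℕ} (𝒜 : ArcSystem n) (a : ℕ → ℕ) where
  open ArcSystem 𝒜

  pointℤ : ZPt
  pointℤ i j = ℤ.+ point a i j

  pointℤ-InΠ : InΠ n a pointℤ
  pointℤ-InΠ = (λ i j _ → ℕ→ℚ-mono-≤ {0} {point a i j} z≤n) , λ d dyck →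
    subst (ℚ._≤ ℕ→ℚ (M a d)) (sym (S-ℕ→ℚ (point a) d)) (ℕ→ℚ-mono-≤ (pathSum-point≤M a dyck))

  -- In the second hypothesis (i′,j) is an entry of the leg of `dpath i j` and (i,j′) one of its
  -- arm. The path therefore meets every level from i to j - 1, which is equality in its bound.
  pointℤ-IsXE : ∀ E → (∀ {k i j} → Arc k i j → T (E i j)) →
    (∀ {k i j} → Valid n i j → T (E i j) → i ≤ k → k < j →
      (∃[ i′ ] i ≤ i′ × Arc k i′ j) ⊎ (∃[ j′ ] j′ ≤ j × Arc k i j′)) →
    IsXE n a E (toPt pointℤ)
  pointℤ-IsXE E arc⇒E hook =
    (λ i j _ ∉E → cong ℕ→ℚ (∑-zero (n ∸ 1) λ k _ _ → trans (cong (a k *_) (𝟙-no (arc? k i j) (∉E ∘ arc⇒E))) (*-zeroʳ (a k)))) ,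
    λ i j v@(_ , i<j , _) ∈E → trans (S-ℕ→ℚ (point a) (dpath i j))
      (cong ℕ→ℚ (trans (pathSum-point≡M a (dpath-dyck v) (hit v ∈E)) (M-dpath a i<j)))
    where
    hit : ∀ {i j} → Valid n i j → T (E i j) → ∀ k → firstI (dpath i j) ≤ k → k ≤ lastI (dpath i j) →
          ∃[ i′ ] ∃[ j′ ] (i′ , j′) ∈ dpath i j × Arc k i′ j′
    hit {i} {suc j} v@(_ , i<j , _) ∈E k f≤k k≤l
      with hook v ∈E (subst (_≤ k) (dpath-firstI i<j) f≤k) (s≤s (subst (k ≤_) (dpath-lastI i<j) k≤l))
    ... | inj₁ (i′ , i≤i′ , A) = i′ , _ , ∈-leg i≤i′ (≤-<-trans (proj₁ (proj₂ (bounds A))) (proj₁ (proj₂ (proj₂ (bounds A))))) , A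
    ... | inj₂ (j′ , j′≤j , A) = _ , j′ , ∈-arm (≤-<-trans (proj₁ (proj₂ (bounds A))) (proj₁ (proj₂ (proj₂ (bounds A))))) j′≤j , A

-- Weights

-- A count with multiplicity; for injective `w` it is the indicator of w{1,...,k}.
members : (ℕ → ℕ) → ℕ → ℕ → ℕ
members w k m = ∑ k λ t → 𝟙 (w t ≟ m)

sumR-eval : ∀ (f : ℕ → Wt) b l m → sumR _⊕_ 0w f b l m ≡ sumR ℤ._+_ ℤ.0ℤ (λ t → f t m) b l
sumR-eval f b zero    m = refl
sumR-eval f b (suc l) m = cong (ℤ._+_ (f b m)) (sumR-eval f (suc b) l m)

sumR-eval-∑ : ∀ (f : ℕ → Wt) l m → sumR _⊕_ 0w f 1 l m ≡ ℤ∑.∑ l (λ t → f t m)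
sumR-eval-∑ f l m = trans (sumR-eval f 1 l m) (ℤ∑.sumR≈∑ (λ t → f t m) l)

ω₀≡0 : ∀ n m → ω n 0 m ≡ ℤ.0ℤ
ω₀≡0 n m with 0 ≟ m | 1 ≤? 0 | 0 <? n
... | yes _ | no _ | _ = refl
... | no _  | _    | _ = refl

∑ε≡ω : ∀ n k m → ℤ∑.∑ k (λ t → ε n t m) ≡ ω n k m
∑ε≡ω n zero    m = sym (ω₀≡0 n m)
∑ε≡ω n (suc k) m = trans (cong (ℤ._+ ε n (suc k) m) (∑ε≡ω n k m)) (cancel (ω n k m) (ω n (suc k) m))
  where
  cancel : ∀ x y → x ℤ.+ (y ℤ.- x) ≡ y
  cancel = solve-∀

sumR-α : ∀ n i l m → sumR ℤ._+_ ℤ.0ℤ (λ t → α n t m) i l ≡ ε n i m ℤ.- ε n (i + l) m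
sumR-α n i zero    m = sym (trans (cong (λ t → ε n i m ℤ.- ε n t m) (+-identityʳ i)) (ℤ.+-inverseʳ (ε n i m)))
sumR-α n i (suc l) m = trans (cong (ℤ._+_ (α n i m)) (sumR-α n (suc i) l m))
  (trans (telescope (ε n i m) (ε n (suc i) m) (ε n (suc i + l) m)) (cong (λ t → ε n i m ℤ.- ε n t m) (sym (+-suc i l))))
  where
  telescope : ∀ x y z → (x ℤ.- y) ℤ.+ (y ℤ.- z) ≡ x ℤ.- z
  telescope = solve-∀

αij≡ε-ε : ∀ n {i j} m → i ≤ j → αij n i j m ≡ ε n i m ℤ.- ε n j m
αij≡ε-ε n {i} {j} m i≤j = trans (sumR-eval (α n) i (j ∸ i) m)
  (trans (sumR-α n i (j ∸ i) m) (cong (λ t → ε n i m ℤ.- ε n t m) (m+[n∸m]≡n i≤j)))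

∑-reindex : ∀ (e : ℕ → ℤ) w k n → (∀ t → 1 ≤ t → t ≤ k → 1 ≤ w t × w t ≤ n) →
            ℤ∑.∑ k (e ∘ w) ≡ ℤ∑.∑ n (λ p → ℤ.+ members w k p ℤ.* e p)
∑-reindex e w k n range = begin
  ℤ∑.∑ k (e ∘ w)                                                          ≡⟨ ℤ∑.∑-cong k delta ⟩
  ℤ∑.∑ k (λ t → ℤ∑.∑ n λ p → ℤ.+ 𝟙 (w t ≟ p) ℤ.* e p)                     ≡⟨ ℤ∑.∑-swap k n _ ⟩
  ℤ∑.∑ n (λ p → ℤ∑.∑ k λ t → ℤ.+ 𝟙 (w t ≟ p) ℤ.* e p)                     ≡⟨ ℤ∑.∑-cong n (λ p _ _ → ℤ∑.∑-*ʳ k (e p) _) ⟩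
  ℤ∑.∑ n (λ p → ℤ∑.∑ k (λ t → ℤ.+ 𝟙 (w t ≟ p)) ℤ.* e p)                   ≡⟨ ℤ∑.∑-cong n (λ p _ _ → cong (ℤ._* e p) (pos-∑ k _)) ⟨
  ℤ∑.∑ n (λ p → ℤ.+ members w k p ℤ.* e p)                                ∎
  where
  open ≡-Reasoning
  delta : ∀ t → 1 ≤ t → t ≤ k → e (w t) ≡ ℤ∑.∑ n λ p → ℤ.+ 𝟙 (w t ≟ p) ℤ.* e p
  delta t 1≤t t≤k with 1≤wt , wt≤n ← range t 1≤t t≤k = sym (trans
    (ℤ∑.∑-single n (w t) 1≤wt wt≤n λ p _ _ p≢ → trans (cong (λ c → ℤ.+ c ℤ.* e p) (𝟙-no (w t ≟ p) (p≢ ∘ sym))) (ℤ.*-zeroˡ (e p)))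
    (trans (cong (λ c → ℤ.+ c ℤ.* e (w t)) (𝟙-yes (w t ≟ w t) refl)) (ℤ.*-identityˡ (e (w t)))))

∑-initial : ∀ (e : ℕ → ℤ) k n → k ≤ n → ℤ∑.∑ k e ≡ ℤ∑.∑ n (λ p → ℤ.+ 𝟙 (p ≤? k) ℤ.* e p)
∑-initial e k n k≤n = sym (trans
  (ℤ∑.∑-final-zeros _ k≤n λ p k<p _ → trans (cong (λ c → ℤ.+ c ℤ.* e p) (𝟙-no (p ≤? k) (<⇒≱ k<p))) (ℤ.*-zeroˡ (e p)))
  (ℤ∑.∑-cong k λ p _ p≤k → trans (cong (λ c → ℤ.+ c ℤ.* e p) (𝟙-yes (p ≤? k) p≤k)) (ℤ.*-identityˡ (e p))))

module _ {n : ℕ} (𝒜 : ArcSystem n) where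
  open ArcSystem 𝒜

  module _ (w : ℕ → ℕ) (w-range : ∀ t → 1 ≤ t → t ≤ n → 1 ≤ w t × w t ≤ n)
           (exchanged : ∀ k m → k < n → 1 ≤ m → m ≤ n → Exchanged k m (members w k m)) where

    -- For `e t` a coordinate of ε_t this says that ω_k - wω_k is the sum of α_{i,j} over the arcs
    -- of level k. Multiplying `balance` by `e p` and summing over p gives it with the right ends
    -- moved to the other side.
    arcs-weight : ∀ (e : ℕ → ℤ) k → k < n →
      ℤ∑.∑ k e ≡ ℤ∑.∑ k (e ∘ w) ℤ.+ ℤ∑.∑ n (λ i → ℤ∑.∑ n λ j → ℤ.+ arcs k i j ℤ.* (e i ℤ.- e j))
    arcs-weight e k k<n = rearrange _ (ℤ∑.∑ k (e ∘ w)) D _ (begin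
      ℤ∑.∑ k e ℤ.+ into                                                    ≡⟨ cong (ℤ._+ into) (∑-initial e k n (<⇒≤ k<n)) ⟩
      ℤ∑.∑ n (λ p → ℤ.+ 𝟙 (p ≤? k) ℤ.* e p) ℤ.+ into                       ≡⟨ ℤ∑.∑-+ n _ _ ⟨
      ℤ∑.∑ n (λ p → ℤ.+ 𝟙 (p ≤? k) ℤ.* e p ℤ.+ ℤ.+ R p ℤ.* e p)            ≡⟨ ℤ∑.∑-cong n pointwise ⟩
      ℤ∑.∑ n (λ p → ℤ.+ members w k p ℤ.* e p ℤ.+ ℤ.+ L p ℤ.* e p)         ≡⟨ ℤ∑.∑-+ n _ _ ⟩
      ℤ∑.∑ n (λ p → ℤ.+ members w k p ℤ.* e p) ℤ.+ out                     ≡⟨ cong (ℤ._+ out) (∑-reindex e w k n λ t 1≤t t≤k → w-range t 1≤t (≤-trans t≤k (<⇒≤ k<n))) ⟨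
      ℤ∑.∑ k (e ∘ w) ℤ.+ out                                               ∎) difference
      where
      open ≡-Reasoning
      L R : ℕ → ℕ
      L p = ∑ n (arcs k p)
      R p = ∑ n (λ i → arcs k i p)
      into out D : ℤ
      into = ℤ∑.∑ n (λ p → ℤ.+ R p ℤ.* e p)
      out  = ℤ∑.∑ n (λ p → ℤ.+ L p ℤ.* e p)
      D = ℤ∑.∑ n (λ i → ℤ∑.∑ n λ j → ℤ.+ arcs k i j ℤ.* (e i ℤ.- e j))

      pointwise : ∀ p → 1 ≤ p → p ≤ n →
        ℤ.+ 𝟙 (p ≤? k) ℤ.* e p ℤ.+ ℤ.+ R p ℤ.* e p ≡ ℤ.+ members w k p ℤ.* e p ℤ.+ ℤ.+ L p ℤ.* e p
      pointwise p 1≤p p≤n = trans (sym (ℤ.*-distribʳ-+ (e p) (ℤ.+ 𝟙 (p ≤? k)) (ℤ.+ R p)))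
        (trans (cong (λ c → ℤ.+ c ℤ.* e p) (balance (exchanged k p k<n 1≤p p≤n)))
               (ℤ.*-distribʳ-+ (e p) (ℤ.+ members w k p) (ℤ.+ L p)))

      out≡ : ℤ∑.∑ n (λ i → ℤ∑.∑ n λ j → ℤ.+ arcs k i j ℤ.* e i) ≡ out
      out≡ = ℤ∑.∑-cong n λ i _ _ → trans (ℤ∑.∑-*ʳ n (e i) _) (cong (ℤ._* e i) (sym (pos-∑ n (arcs k i))))

      into≡ : ℤ∑.∑ n (λ i → ℤ∑.∑ n λ j → ℤ.+ arcs k i j ℤ.* e j) ≡ into
      into≡ = trans (ℤ∑.∑-swap n n _)
        (ℤ∑.∑-cong n λ j _ _ → trans (ℤ∑.∑-*ʳ n (e j) _) (cong (ℤ._* e j) (sym (pos-∑ n (λ i → arcs k i j)))))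

      difference : D ℤ.+ into ≡ out
      difference = begin
        D ℤ.+ into ≡⟨ cong (ℤ._+_ D) into≡ ⟨
        D ℤ.+ ℤ∑.∑ n (λ i → ℤ∑.∑ n λ j → ℤ.+ arcs k i j ℤ.* e j)          ≡⟨ ℤ∑.∑-+ n _ _ ⟨
        ℤ∑.∑ n (λ i → ℤ∑.∑ n (λ j → ℤ.+ arcs k i j ℤ.* (e i ℤ.- e j)) ℤ.+ ℤ∑.∑ n (λ j → ℤ.+ arcs k i j ℤ.* e j))
          ≡⟨ ℤ∑.∑-cong n (λ i _ _ → trans (sym (ℤ∑.∑-+ n _ _)) (ℤ∑.∑-cong n λ j _ _ → cancel (ℤ.+ arcs k i j) (e i) (e j))) ⟩
        ℤ∑.∑ n (λ i → ℤ∑.∑ n λ j → ℤ.+ arcs k i j ℤ.* e i)               ≡⟨ out≡ ⟩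
        out ∎
        where
        cancel : ∀ c x y → c ℤ.* (x ℤ.- y) ℤ.+ c ℤ.* y ≡ c ℤ.* x
        cancel = solve-∀

      rearrange : ∀ x y z o {i} → x ℤ.+ i ≡ y ℤ.+ o → z ℤ.+ i ≡ o → x ≡ y ℤ.+ z
      rearrange x y z o {i} eq refl = ℤGroup.∙-cancelʳ i x (y ℤ.+ z) (trans eq (sym (ℤ.+-assoc y z i)))

    pointℤ-weight : ∀ a → μ n a (pointℤ 𝒜 a) ≈w[ n ] wlam n a w
    pointℤ-weight a m 1≤m m<n = begin
      lam n a m ℤ.- roots m                    ≡⟨ cong₂ ℤ._-_ lam≡ roots≡ ⟩
      (W ℤ.+ D) ℤ.- D                          ≡⟨ cancel W D ⟩
      W                                        ≡⟨ wlam≡ ⟨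
      wlam n a w m                             ∎
      where
      open ≡-Reasoning
      N = n ∸ 1
      e : ℕ → ℤ
      e t = ε n t m
      roots : Wt
      roots = sumW (λ i → sumW (λ j → pointℤ 𝒜 a i j · αij n i j) (suc i) (suc n)) 1 (suc n)
      Dₖ : ℕ → ℤ
      Dₖ k = ℤ∑.∑ n (λ i → ℤ∑.∑ n λ j → ℤ.+ arcs k i j ℤ.* (e i ℤ.- e j))
      W D : ℤ
      W = ℤ∑.∑ N (λ k → ℤ.+ a k ℤ.* ℤ∑.∑ k (e ∘ w))
      D = ℤ∑.∑ N (λ k → ℤ.+ a k ℤ.* Dₖ k)

      cancel : ∀ x y → (x ℤ.+ y) ℤ.- y ≡ x
      cancel = solve-∀

      k<n : ∀ {k} → k ≤ N → k < n
      k<n k≤N = <-≤-trans (s≤s k≤N) (≤-reflexive (m+[n∸m]≡n (≤-trans 1≤m (<⇒≤ m<n))))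

      lam≡ : lam n a m ≡ W ℤ.+ D
      lam≡ = begin
        lam n a m                                                             ≡⟨ sumR-eval-∑ _ N m ⟩
        ℤ∑.∑ N (λ k → ℤ.+ a k ℤ.* ω n k m)                                    ≡⟨ ℤ∑.∑-cong N (λ k _ k≤N → trans (cong (ℤ.+ a k ℤ.*_)
                                                                                  (trans (sym (∑ε≡ω n k m)) (arcs-weight e k (k<n k≤N))))
                                                                                  (ℤ.*-distribˡ-+ (ℤ.+ a k) _ _)) ⟩
        ℤ∑.∑ N (λ k → ℤ.+ a k ℤ.* ℤ∑.∑ k (e ∘ w) ℤ.+ ℤ.+ a k ℤ.* Dₖ k)       ≡⟨ ℤ∑.∑-+ N _ _ ⟩
        W ℤ.+ D                                                               ∎

      wlam≡ : wlam n a w m ≡ W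
      wlam≡ = trans (sumR-eval-∑ _ N m) (ℤ∑.∑-cong N λ k _ _ → cong (ℤ.+ a k ℤ.*_) (sumR-eval-∑ _ k m))

      pointℤ≡ : ∀ i j → pointℤ 𝒜 a i j ≡ ℤ∑.∑ N (λ k → ℤ.+ a k ℤ.* ℤ.+ arcs k i j)
      pointℤ≡ i j = trans (pos-∑ N _) (ℤ∑.∑-cong N λ k _ _ → ℤ.pos-* (a k) (arcs k i j))

      -- The point vanishes for j ≤ i, so each row extends to 1,...,n. With bounds independent of i,
      -- the sum over levels can be moved outside.
      row≡ : ∀ i → i ≤ n → sumW (λ j → pointℤ 𝒜 a i j · αij n i j) (suc i) (suc n) m ≡ ℤ∑.∑ n (λ j → pointℤ 𝒜 a i j ℤ.* (e i ℤ.- e j))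
      row≡ i i≤n = begin
        sumW (λ j → pointℤ 𝒜 a i j · αij n i j) (suc i) (suc n) m                        ≡⟨ sumR-eval _ (suc i) (n ∸ i) m ⟩
        sumR ℤ._+_ ℤ.0ℤ (λ j → pointℤ 𝒜 a i j ℤ.* αij n i j m) (suc i) (n ∸ i)           ≡⟨ ℤ∑.sumR-cong (suc i) (n ∸ i) (λ j i<j _ →
          cong (pointℤ 𝒜 a i j ℤ.*_) (αij≡ε-ε n m (<⇒≤ i<j))) ⟩
        sumR ℤ._+_ ℤ.0ℤ (λ j → pointℤ 𝒜 a i j ℤ.* (e i ℤ.- e j)) (suc i) (n ∸ i)         ≡⟨ ℤ∑.∑-initial-zeros _ i n i≤n (λ j _ j≤i →
          trans (cong (λ c → ℤ.+ c ℤ.* (e i ℤ.- e j)) (vanish j≤i)) (ℤ.*-zeroˡ (e i ℤ.- e j))) ⟩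
        ℤ∑.∑ n (λ j → pointℤ 𝒜 a i j ℤ.* (e i ℤ.- e j))                                  ∎
        where
        vanish : ∀ {j} → j ≤ i → point a i j ≡ 0
        vanish {j} j≤i = ∑-zero N λ k _ _ → trans (cong (a k *_) (𝟙-no (arc? k i j) λ A →
          <⇒≱ (≤-<-trans (proj₁ (proj₂ (bounds A))) (proj₁ (proj₂ (proj₂ (bounds A))))) j≤i)) (*-zeroʳ (a k))

      roots≡ : roots m ≡ D
      roots≡ = begin
        roots m ≡⟨ sumR-eval-∑ _ n m ⟩
        ℤ∑.∑ n (λ i → sumW (λ j → pointℤ 𝒜 a i j · αij n i j) (suc i) (suc n) m)         ≡⟨ ℤ∑.∑-cong n (λ i _ → row≡ i) ⟩
        ℤ∑.∑ n (λ i → ℤ∑.∑ n λ j → pointℤ 𝒜 a i j ℤ.* (e i ℤ.- e j))                     ≡⟨ ℤ∑.∑-cong n (λ i _ _ → ℤ∑.∑-cong n λ j _ _ → entry i j) ⟩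
        ℤ∑.∑ n (λ i → ℤ∑.∑ n λ j → ℤ∑.∑ N λ k → ℤ.+ a k ℤ.* (ℤ.+ arcs k i j ℤ.* (e i ℤ.- e j)))  ≡⟨ ℤ∑.∑-cong n (λ i _ _ → ℤ∑.∑-swap n N _) ⟩
        ℤ∑.∑ n (λ i → ℤ∑.∑ N λ k → ℤ∑.∑ n λ j → ℤ.+ a k ℤ.* (ℤ.+ arcs k i j ℤ.* (e i ℤ.- e j)))  ≡⟨ ℤ∑.∑-swap n N _ ⟩
        ℤ∑.∑ N (λ k → ℤ∑.∑ n λ i → ℤ∑.∑ n λ j → ℤ.+ a k ℤ.* (ℤ.+ arcs k i j ℤ.* (e i ℤ.- e j)))  ≡⟨ ℤ∑.∑-cong N (λ k _ _ → trans
                                                                                                     (ℤ∑.∑-cong n λ i _ _ → ℤ∑.∑-*ˡ n (ℤ.+ a k) _) (ℤ∑.∑-*ˡ n (ℤ.+ a k) _)) ⟩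
        D ∎
        where
        entry : ∀ i j → pointℤ 𝒜 a i j ℤ.* (e i ℤ.- e j) ≡ ℤ∑.∑ N λ k → ℤ.+ a k ℤ.* (ℤ.+ arcs k i j ℤ.* (e i ℤ.- e j))
        entry i j = trans (cong (ℤ._* (e i ℤ.- e j)) (pointℤ≡ i j)) (trans (sym (ℤ∑.∑-*ʳ N (e i ℤ.- e j) _))
          (ℤ∑.∑-cong N λ k _ _ → ℤ.*-assoc (ℤ.+ a k) (ℤ.+ arcs k i j) _))

-- From permutations to segments

∑-prefix-≤ : ∀ f {p q} → p ≤ q → ∑ p f ≤ ∑ q f
∑-prefix-≤ f {p} {q} p≤q = subst (λ q → ∑ p f ≤ ∑ q f) (m+[n∸m]≡n p≤q)
  (≤-trans (m≤m+n (∑ p f) _) (≤-reflexive (sym (∑-split f p (q ∸ p)))))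

∑-prefix-< : ∀ f {p q} → p < q → f q ≡ 1 → ∑ p f < ∑ q f
∑-prefix-< f {p} {suc q} (s≤s p≤q) fq≡1 = begin-strict
  ∑ p f               ≤⟨ ∑-prefix-≤ f p≤q ⟩
  ∑ q f               <⟨ n<1+n _ ⟩
  suc (∑ q f)         ≡⟨ +-comm 1 _ ⟩
  ∑ q f + 1           ≡⟨ cong (∑ q f +_) fq≡1 ⟨
  ∑ (suc q) f         ∎
  where open ≤-Reasoning

∑-δ≤1 : ∀ x n → ∑ n (λ m → 𝟙 (x ≟ m)) ≤ 1
∑-δ≤1 x zero = z≤n
∑-δ≤1 x (suc n) with x ≟ suc n
... | yes refl = ≤-reflexive (cong (_+ 1) (∑-zero n λ t _ t≤n → 𝟙-no (x ≟ t) (<⇒≢ (s≤s t≤n) ∘ sym)))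
... | no _     = ≤-trans (≤-reflexive (+-identityʳ _)) (∑-δ≤1 x n)

zero-or-one : ∀ {m} → m ≤ 1 → m ≡ 0 ⊎ m ≡ 1
zero-or-one z≤n       = inj₁ refl
zero-or-one (s≤s z≤n) = inj₂ refl

members≤1 : ∀ {n w} → IsPerm n w → ∀ {k} m → k ≤ n → members w k m ≤ 1
members≤1 perm {zero} m _ = z≤n
members≤1 {n} {w} perm {suc k} m k<n with w (suc k) ≟ m
... | no _     = ≤-trans (≤-reflexive (+-identityʳ _)) (members≤1 perm m (<⇒≤ k<n))
... | yes refl = ≤-reflexive (cong (_+ 1) (∑-zero k λ t 1≤t t≤k → 𝟙-no (w t ≟ m) λ wt≡m →
  <⇒≢ (s≤s t≤k) (proj₂ perm t (suc k) 1≤t (≤-trans t≤k (<⇒≤ k<n)) (s≤s z≤n) k<n wt≡m)))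

suc-mono⇒mono : ∀ (f : ℕ → ℕ) → (∀ k → f k ≤ f (suc k)) → ∀ {k k′} → k ≤ k′ → f k ≤ f k′
suc-mono⇒mono f step {k} {zero} k≤k′ = ≤-reflexive (cong f (n≤0⇒n≡0 k≤k′))
suc-mono⇒mono f step {k} {suc k′} k≤k′ with k ≟ suc k′
... | yes refl = ≤-refl
... | no k≢    = ≤-trans (suc-mono⇒mono f step (m≤1+n∧m≢1+n⇒m≤n k≤k′ k≢)) (step k′)

-- χ k is the indicator of w{1,…,k}; it is a parameter so that it does not unfold.
module FromPermutation {n : ℕ} {w : ℕ → ℕ} (perm : IsPerm n w) (χ : ℕ → ℕ → ℕ)
  (χ-zero : ∀ m → χ 0 m ≡ 0) (χ-suc : ∀ k m → χ (suc k) m ≡ χ k m + 𝟙 (w (suc k) ≟ m))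
  (χ≤1 : ∀ {k} m → k ≤ n → χ k m ≤ 1) where

  χ-mono : ∀ {k k′} m → k ≤ k′ → χ k m ≤ χ k′ m
  χ-mono m = suc-mono⇒mono (λ k → χ k m) λ k → ≤-trans (m≤m+n _ _) (≤-reflexive (sym (χ-suc k m)))

  χ≡1-later : ∀ {k k′ m} → k ≤ k′ → k′ ≤ n → χ k m ≡ 1 → χ k′ m ≡ 1
  χ≡1-later {m = m} k≤k′ k′≤n χ≡1 = ≤-antisym (χ≤1 m k′≤n) (≤-trans (≤-reflexive (sym χ≡1)) (χ-mono m k≤k′))

  χ≡0-earlier : ∀ {k k′ m} → k ≤ k′ → χ k′ m ≡ 0 → χ k m ≡ 0
  χ≡0-earlier {m = m} k≤k′ χ≡0 = n≤0⇒n≡0 (≤-trans (χ-mono m k≤k′) (≤-reflexive χ≡0))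

  C Z : ℕ → ℕ → ℕ
  C k p = ∑ p (χ k)
  Z k p = ∑ p λ m → 1 ∸ χ k m

  -- For i ≤ k < j, `H k i j` - k is the number of members of w{1,...,k} in k+1,...,j minus the
  -- number of nonmembers in i+1,...,k. This form needs no subtraction and makes sense for all i and
  -- j.
  H : ℕ → ℕ → ℕ → ℕ
  H k i j = C k j + Z k i

  C+Z : ∀ {k} p → k ≤ n → C k p + Z k p ≡ p
  C+Z zero    k≤n = refl
  C+Z {k} (suc p) k≤n = begin
    (C k p + χ k (suc p)) + (Z k p + (1 ∸ χ k (suc p)))   ≡⟨ interchange (C k p) (χ k (suc p)) (Z k p) _ ⟩
    (C k p + Z k p) + (χ k (suc p) + (1 ∸ χ k (suc p)))   ≡⟨ cong₂ _+_ (C+Z p k≤n) (m+[n∸m]≡n (χ≤1 (suc p) k≤n)) ⟩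
    p + 1                                                 ≡⟨ +-comm p 1 ⟩
    suc p                                                 ∎
    where open ≡-Reasoning

  C-total : ∀ {k} → k ≤ n → C k n ≡ k
  C-total {zero}  _ = ∑-zero n λ m _ _ → χ-zero m
  C-total {suc k} k<n with 1≤w , w≤n ← proj₁ perm (suc k) (s≤s z≤n) k<n = begin
    C (suc k) n                                  ≡⟨ trans (∑-cong n λ m _ _ → χ-suc k m) (∑-+ n (χ k) _) ⟩
    C k n + ∑ n (λ m → 𝟙 (w (suc k) ≟ m))        ≡⟨ cong₂ _+_ (C-total (<⇒≤ k<n)) (trans
                                                      (∑-single n (w (suc k)) 1≤w w≤n λ t _ _ t≢ → 𝟙-no (w (suc k) ≟ t) (t≢ ∘ sym))
                                                      (𝟙-yes (w (suc k) ≟ w (suc k)) refl)) ⟩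
    k + 1                                        ≡⟨ +-comm k 1 ⟩
    suc k                                        ∎
    where open ≡-Reasoning

  C≤k : ∀ {k p} → k ≤ n → p ≤ n → C k p ≤ k
  C≤k {k} k≤n p≤n = ≤-trans (∑-prefix-≤ (χ k) p≤n) (≤-reflexive (C-total k≤n))

  Z-< : ∀ {k p q} → p < q → χ k q ≡ 0 → Z k p < Z k q
  Z-< {k} p<q χ≡0 = ∑-prefix-< (λ m → 1 ∸ χ k m) p<q (cong (1 ∸_) χ≡0)

  module _ {k i j} (k<n : k < n) (i≤j : i ≤ j) where
    private
      δ : ℕ → ℕ
      δ m = 𝟙 (w (suc k) ≟ m)

      Z-step : Z (suc k) i + ∑ i δ ≡ Z k i
      Z-step = trans (sym (∑-+ i _ δ)) (∑-cong i λ m _ _ → begin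
        (1 ∸ χ (suc k) m) + δ m         ≡⟨ cong (λ c → 1 ∸ c + δ m) (χ-suc k m) ⟩
        (1 ∸ (χ k m + δ m)) + δ m       ≡⟨ cong (_+ δ m) (∸-+-assoc 1 (χ k m) (δ m)) ⟨
        (1 ∸ χ k m ∸ δ m) + δ m         ≡⟨ m∸n+n≡m (m+n≤o⇒m≤o∸n (δ m) (subst (_≤ 1) (trans (χ-suc k m) (+-comm (χ k m) (δ m))) (χ≤1 m k<n))) ⟩
        1 ∸ χ k m                       ∎)
        where open ≡-Reasoning

      -- Adding w(k+1) raises `C k j` if w(k+1) ≤ j and lowers `Z k i` if w(k+1) ≤ i. As i ≤ j, the
      -- net change is 1 if i < w(k+1) ≤ j and 0 otherwise.
      H-step : H (suc k) i j + ∑ i δ ≡ H k i j + ∑ j δ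
      H-step = begin
        (C (suc k) j + Z (suc k) i) + ∑ i δ     ≡⟨ +-assoc (C (suc k) j) _ _ ⟩
        C (suc k) j + (Z (suc k) i + ∑ i δ)     ≡⟨ cong₂ _+_ (trans (∑-cong j λ m _ _ → χ-suc k m) (∑-+ j (χ k) δ)) Z-step ⟩
        (C k j + ∑ j δ) + Z k i                 ≡⟨ xy∙z≈xz∙y (C k j) _ _ ⟩
        H k i j + ∑ j δ                         ∎
        where open ≡-Reasoning

    H-suc-≤ : H (suc k) i j ≤ suc (H k i j)
    H-suc-≤ = begin
      H (suc k) i j             ≤⟨ m≤m+n _ _ ⟩
      H (suc k) i j + ∑ i δ     ≡⟨ H-step ⟩
      H k i j + ∑ j δ           ≤⟨ +-monoʳ-≤ _ (∑-δ≤1 (w (suc k)) j) ⟩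
      H k i j + 1               ≡⟨ +-comm _ 1 ⟩
      suc (H k i j)             ∎
      where open ≤-Reasoning

    H-≤-suc : H k i j ≤ H (suc k) i j
    H-≤-suc = +-cancelʳ-≤ (∑ j δ) _ _ (≤-trans (≤-reflexive (sym H-step)) (+-monoʳ-≤ _ (∑-prefix-≤ δ i≤j)))

  -- Free of subtraction, this expresses that `H k i j` - k does not increase with k.
  H-slope : ∀ {k k′ i j} → k ≤ k′ → k′ ≤ n → i ≤ j → H k′ i j + k ≤ H k i j + k′
  H-slope {k} {k′} {i} {j} k≤k′ k′≤n i≤j with k ≟ k′
  ... | yes refl = ≤-refl
  H-slope {k} {zero}   k≤k′ k′≤n i≤j | no k≢k′ = contradiction (n≤0⇒n≡0 k≤k′) k≢k′
  H-slope {k} {suc k′} {i} {j} k≤k′ k′<n i≤j | no k≢k′ = begin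
    H (suc k′) i j + k      ≤⟨ +-monoˡ-≤ k (H-suc-≤ k′<n i≤j) ⟩
    suc (H k′ i j + k)      ≤⟨ s≤s (H-slope (m≤1+n∧m≢1+n⇒m≤n k≤k′ k≢k′) (<⇒≤ k′<n) i≤j) ⟩
    suc (H k i j + k′)      ≡⟨ +-suc _ k′ ⟨
    H k i j + suc k′        ∎
    where open ≤-Reasoning

  -- Since C k k + Z k k ≡ k, the last equation says that [i,k] contains as many
  -- nonmembers of w{1,…,k} as [k+1,j] contains members.
  Arc : ℕ → ℕ → ℕ → Set
  Arc k i j = (1 ≤ i × i ≤ k × k < j × j ≤ n) × χ k i ≡ 0 × χ k j ≡ 1 × H k i j ≡ suc k

  arc? : ∀ k i j → Dec (Arc k i j)
  arc? k i j = (1 ≤? i ×-dec i ≤? k ×-dec k <? j ×-dec j ≤? n) ×-dec χ k i ≟ 0 ×-dec χ k j ≟ 1 ×-dec H k i j ≟ suc k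

  -- `H k` is monotone in both endpoints, and strictly so when the left one moves up to a nonmember
  -- or the right one to a member; both arcs have the same value.
  antichain : ∀ {k i j i′ j′} → Arc k i j → Arc k i′ j′ → i ≤ i′ → j ≤ j′ → i ≡ i′ × j ≡ j′
  antichain {k} {i} {j} {i′} {j′} (_ , _ , _ , H≡) (_ , χi′≡0 , χj′≡1 , H′≡) i≤i′ j≤j′ = i≡i′ , j≡j′
    where
    i≡i′ : i ≡ i′
    i≡i′ with i ≟ i′
    ... | yes eq = eq
    ... | no i≢i′ = contradiction (trans H≡ (sym H′≡)) (<⇒≢ (+-mono-≤-< (∑-prefix-≤ (χ k) j≤j′) (Z-< (≤∧≢⇒< i≤i′ i≢i′) χi′≡0)))
    j≡j′ : j ≡ j′
    j≡j′ with j ≟ j′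
    ... | yes eq = eq
    ... | no j≢j′ = contradiction (trans H≡ (sym H′≡)) (<⇒≢ (+-mono-<-≤ (∑-prefix-< (χ k) (≤∧≢⇒< j≤j′ j≢j′) χj′≡1) (∑-prefix-≤ (λ m → 1 ∸ χ k m) i≤i′)))

  arcSystem : ArcSystem n
  arcSystem = record { Arc = Arc ; arc? = arc? ; bounds = proj₁ ; antichain = antichain }

  -- While the right end runs from `k` to `J`, the count passes from at most `k` to above `k`. It
  -- grows only at members, and there by one, so it first exceeds `k` at a member and with value k +
  -- 1.
  arc-from : ∀ {k i J} → 1 ≤ i → i ≤ k → χ k i ≡ 0 → k ≤ J → J ≤ n → k < H k i J → ∃[ j ] j ≤ J × Arc k i j
  arc-from {k} {i} {J} 1≤i i≤k χ≡0 k≤J J≤n k<H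
    with t , k≤t , t<J , ≤k , ≰k ← crossing (λ t → H k i t ≤? k) J k≤J
           (≤-trans (+-monoʳ-≤ (C k k) (∑-prefix-≤ _ i≤k)) (≤-reflexive (C+Z k (≤-trans k≤J J≤n)))) (<⇒≱ k<H)
    with zero-or-one (χ≤1 (suc t) (≤-trans k≤J J≤n))
  ... | inj₁ χ≡0′ = contradiction (subst (λ c → c + Z k i ≤ k) (sym (trans (cong (C k t +_) χ≡0′) (+-identityʳ _))) ≤k) ≰k
  ... | inj₂ χ≡1 = suc t , t<J , (1≤i , i≤k , s≤s k≤t , ≤-trans t<J J≤n) , χ≡0 , χ≡1 ,
    ≤-antisym (subst (λ c → c + Z k i ≤ suc k) (sym (trans (cong (C k t +_) χ≡1) (+-comm _ 1))) (s≤s ≤k)) (≰⇒> ≰k)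

  -- The mirror image of `arc-from`: the left end runs from `p` to `k`, where the count exceeds `k`
  -- because `j` is a member.
  arc-to : ∀ {k p j} → k < j → j ≤ n → χ k j ≡ 1 → p ≤ k → H k p j ≤ k → ∃[ i ] p < i × Arc k i j
  arc-to {k} {p} {j} k<j j≤n χ≡1 p≤k H≤k
    with t , p≤t , t<k , ≤k , ≰k ← crossing (λ t → H k t j ≤? k) k p≤k H≤k
           (<⇒≱ (subst (_< H k k j) (C+Z k (≤-trans (<⇒≤ k<j) j≤n)) (+-monoˡ-< (Z k k) (∑-prefix-< (χ k) k<j χ≡1))))
    with zero-or-one (χ≤1 (suc t) (≤-trans (<⇒≤ k<j) j≤n))
  ... | inj₂ χ≡1′ = contradiction (subst (λ c → C k j + c ≤ k) (sym (trans (cong (λ x → Z k t + (1 ∸ x)) χ≡1′) (+-identityʳ _))) ≤k) ≰k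
  ... | inj₁ χ≡0 = suc t , s≤s p≤t , (s≤s z≤n , t<k , k<j , j≤n) , χ≡0 , χ≡1 ,
    ≤-antisym (subst (_≤ suc k) (sym (H-suc χ≡0)) (s≤s ≤k)) (≰⇒> ≰k)
    where
    H-suc : χ k (suc t) ≡ 0 → H k (suc t) j ≡ suc (H k t j)
    H-suc χ≡0 = trans (cong (λ x → C k j + (Z k t + (1 ∸ x))) χ≡0) (trans (cong (C k j +_) (+-comm (Z k t) 1)) (+-suc (C k j) (Z k t)))

  -- A nonmember m ≤ k starts an arc because `H k m n` = k + `Z k m` exceeds k; a member m > k ends
  -- one because `H k 0 m` = `C k m` is at most k.
  exchanged : ∀ k m → k < n → 1 ≤ m → m ≤ n → ArcSystem.Exchanged arcSystem k m (χ k m)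
  exchanged k m k<n 1≤m m≤n = record { low = low ; high = high }
    where
    low : m ≤ k → (χ k m ≡ 1 × (∀ j → ¬ Arc k m j)) ⊎ (χ k m ≡ 0 × ∃[ j ] Arc k m j)
    low m≤k with zero-or-one (χ≤1 m (<⇒≤ k<n))
    ... | inj₂ χ≡1 = inj₁ (χ≡1 , λ { j (_ , χ≡0 , _) → contradiction (trans (sym χ≡0) χ≡1) λ () })
    ... | inj₁ χ≡0 with j , _ , A ← arc-from 1≤m m≤k χ≡0 (<⇒≤ k<n) ≤-refl
                     (subst (λ c → k < c + Z k m) (sym (C-total (<⇒≤ k<n))) (m<m+n k (Z-< 1≤m χ≡0))) = inj₂ (χ≡0 , j , A)
    high : k < m → (χ k m ≡ 0 × (∀ i → ¬ Arc k i m)) ⊎ (χ k m ≡ 1 × ∃[ i ] Arc k i m)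
    high k<m with zero-or-one (χ≤1 m (<⇒≤ k<n))
    ... | inj₁ χ≡0 = inj₁ (χ≡0 , λ { j (_ , _ , χ≡1 , _) → contradiction (trans (sym χ≡0) χ≡1) λ () })
    ... | inj₂ χ≡1 with i , _ , A ← arc-to k<m m≤n χ≡1 z≤n
                     (≤-trans (≤-reflexive (+-identityʳ _)) (C≤k (<⇒≤ k<n) m≤n)) = inj₂ (χ≡1 , i , A)

  segment? : ∀ i j → Dec (∃[ k ] k < n × Arc k i j)
  segment? i j = anyUpTo? (λ k → arc? k i j) n

  abstract
    segments : Subset
    segments i j = ⌊ segment? i j ⌋

    arc⇒segment : ∀ {k i j} → Arc k i j → T (segments i j)
    arc⇒segment {k} {i} {j} A@((_ , _ , k<j , j≤n) , _) = fromWitness {a? = segment? i j} (k , <-≤-trans k<j j≤n , A)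

    segment⇒arc : ∀ {i j} → T (segments i j) → ∃[ k ] Arc k i j
    segment⇒arc {i} {j} seg with k , _ , A ← toWitness {a? = segment? i j} seg = k , A

  -- If [i,j] is an arc of level k₀, then `i` is a nonmember at all earlier levels and `j` a member
  -- at all later ones. By `H-slope`, the count is large enough before k₀ for `arc-from` at `i`, and
  -- small enough after k₀ for `arc-to` at `j`.
  hook : ∀ {k i j} → Valid n i j → T (segments i j) → i ≤ k → k < j →
         (∃[ i′ ] i ≤ i′ × Arc k i′ j) ⊎ (∃[ j′ ] j′ ≤ j × Arc k i j′)
  hook {k} {suc p} {j} (_ , i<j , j≤n) seg i≤k k<j with segment⇒arc seg
  ... | k₀ , (_ , _ , k₀<j , _) , χi≡0 , χj≡1 , H≡ with ≤-total k₀ k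
  ... | inj₁ k₀≤k = inj₁ (arc-to k<j j≤n (χ≡1-later k₀≤k k≤n χj≡1) (<⇒≤ i≤k)
                      (+-cancelʳ-≤ k₀ _ _ (≤-trans (H-slope k₀≤k k≤n (<⇒≤ (<⇒≤ i<j))) (≤-reflexive (trans (cong (_+ k) H₀≡) (+-comm k₀ k))))))
    where
    k≤n = ≤-trans (<⇒≤ k<j) j≤n
    -- Here `p` is i - 1; leaving out the nonmember i lowers the count by one.
    H₀≡ : H k₀ p j ≡ k₀
    H₀≡ = suc-injective (trans (sym (trans (cong (λ x → C k₀ j + (Z k₀ p + (1 ∸ x))) χi≡0)
            (trans (cong (C k₀ j +_) (+-comm (Z k₀ p) 1)) (+-suc (C k₀ j) (Z k₀ p))))) H≡)
  ... | inj₂ k≤k₀ = inj₂ (arc-from (s≤s z≤n) i≤k (χ≡0-earlier k≤k₀ χi≡0) (<⇒≤ k<j) j≤n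
                      (+-cancelʳ-≤ k₀ _ _ (≤-trans (≤-reflexive (trans (cong suc (+-comm k k₀)) (cong (_+ k) (sym H≡))))
                        (H-slope k≤k₀ (≤-trans (<⇒≤ k₀<j) j≤n) (<⇒≤ i<j)))))

  -- The first arc forces `H t i′ j` above t at t = k, the second keeps it at most t at t = k′.
  -- Where the excess is lost the count does not decrease, so just before it equals t + 1, the
  -- condition for an arc.
  overlap-arc : ∀ {k k′ i j i′ j′} → Arc k i j → Arc k′ i′ j′ → i ≤ i′ → j < j′ → i′ ≤ j → ∃[ t ] Arc t i′ j
  overlap-arc {k} {k′} {i} {j} {i′} {j′} ((1≤i , _ , k<j , j≤n) , _ , χj≡1 , H≡) ((_ , _ , k′<j′ , j′≤n) , χi′≡0 , χj′≡1 , H′≡) i≤i′ j<j′ i′≤j =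
    conclude (crossing (λ t → t <? H t i′ j) k′ k≤k′ H>k (≤⇒≯ H′≤k′))
    where
    k≤n = ≤-trans (<⇒≤ k<j) j≤n
    k′≤n = ≤-trans (<⇒≤ k′<j′) j′≤n

    H>k : k < H k i′ j
    H>k = ≤-trans (≤-reflexive (sym H≡)) (+-monoʳ-≤ (C k j) (∑-prefix-≤ _ i≤i′))

    H′≤k′ : H k′ i′ j ≤ k′
    H′≤k′ = ≤-pred (≤-trans (+-monoˡ-< (Z k′ i′) (∑-prefix-< (χ k′) j<j′ χj′≡1)) (≤-reflexive H′≡))

    k≤k′ : k ≤ k′
    k≤k′ = ≮⇒≥ λ k′<k → <⇒≱ H>k (+-cancelʳ-≤ k′ _ _
      (≤-trans (H-slope (<⇒≤ k′<k) k≤n i′≤j) (≤-trans (+-monoˡ-≤ k H′≤k′) (≤-reflexive (+-comm k′ k)))))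

    conclude : ∃[ t ] k ≤ t × t < k′ × t < H t i′ j × ¬ (suc t < H (suc t) i′ j) → ∃[ t ] Arc t i′ j
    conclude (t , k≤t , t<k′ , t<H , ≮H) = t , (≤-trans 1≤i i≤i′ , i′≤t , t<j , j≤n) , χi≡0 , χj≡1′ , Ht≡
      where
      t<n = <-≤-trans t<k′ k′≤n
      t≤n = <⇒≤ t<n
      χi≡0 : χ t i′ ≡ 0
      χi≡0 = χ≡0-earlier (<⇒≤ t<k′) χi′≡0
      χj≡1′ : χ t j ≡ 1
      χj≡1′ = χ≡1-later k≤t t≤n χj≡1
      Ht≡ : H t i′ j ≡ suc t
      Ht≡ = ≤-antisym (≤-trans (H-≤-suc t<n i′≤j) (≮⇒≥ ≮H)) t<H
      -- The count also locates `t`: for j ≤ t it would be at most `C t j + Z t j` = j, and for t <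
      -- i′ both ends would add to `C t t + Z t t` = t, giving at least t + 2.
      t<j : t < j
      t<j = ≰⇒> λ j≤t → <⇒≱ t<H (≤-trans (+-monoʳ-≤ (C t j) (∑-prefix-≤ _ i′≤j)) (≤-trans (≤-reflexive (C+Z j t≤n)) j≤t))
      i′≤t : i′ ≤ t
      i′≤t = ≮⇒≥ λ t<i′ → <-irrefl (sym Ht≡) (subst (_< H t i′ j) (trans (+-suc (C t t) (Z t t)) (cong suc (C+Z t t≤n)))
        (+-mono-<-≤ (∑-prefix-< (χ t) t<j χj≡1′) (Z-< t<i′ χi≡0)))

  segments-meet : ∀ {i j k l} → T (segments i j) → T (segments k l) → i ≤ k → j ≤ l → k ≤ j → k < l →
                  k < j × T (segments k j)
  segments-meet {i} {j} {k} {l} ij kl i≤k j≤l k≤j k<l with j ≟ l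
  ... | yes refl = k<l , kl
  ... | no j≢l = conclude (overlap-arc (proj₂ (segment⇒arc ij)) (proj₂ (segment⇒arc kl)) i≤k (≤∧≢⇒< j≤l j≢l) k≤j)
    where
    conclude : ∃[ t ] Arc t k j → k < j × T (segments k j)
    conclude (t , A@((_ , k≤t , t<j , _) , _)) = ≤-<-trans k≤t t<j , arc⇒segment A

  segments-InRp : InRp n segments
  segments-InRp i j k l (_ , i<j , _) (_ , k<l , _) ij kl max≤min with ≤-total i k | ≤-total j l
  ... | inj₁ i≤k | inj₁ j≤l rewrite m≤n⇒m⊔n≡n i≤k | m≤n⇒m⊓n≡m j≤l = segments-meet ij kl i≤k j≤l max≤min k<l
  ... | inj₁ i≤k | inj₂ l≤j rewrite m≤n⇒m⊔n≡n i≤k | m≥n⇒m⊓n≡n l≤j = k<l , kl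
  ... | inj₂ k≤i | inj₁ j≤l rewrite m≥n⇒m⊔n≡m k≤i | m≤n⇒m⊓n≡m j≤l = i<j , ij
  ... | inj₂ k≤i | inj₂ l≤j rewrite m≥n⇒m⊔n≡m k≤i | m≥n⇒m⊓n≡n l≤j = segments-meet kl ij k≤i l≤j max≤min i<j

-- From segments to permutations

∑-≡⇒pointwise : ∀ n {f g} → (∀ t → 1 ≤ t → t ≤ n → f t ≤ g t) → ∑ n g ≡ ∑ n f → ∀ t → 1 ≤ t → t ≤ n → g t ≡ f t
∑-≡⇒pointwise zero    f≤g ∑≡ t 1≤t t≤n = contradiction (≤-trans 1≤t t≤n) λ ()
∑-≡⇒pointwise (suc n) {f} {g} f≤g ∑≡ t 1≤t t≤n = helper (t ≟ suc n)
  where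
  f≤g′ : ∀ t → 1 ≤ t → t ≤ n → f t ≤ g t
  f≤g′ t 1≤t t≤n = f≤g t 1≤t (m≤n⇒m≤1+n t≤n)
  last≡ : g (suc n) ≡ f (suc n)
  last≡ = ≤-antisym
    (+-cancelˡ-≤ (∑ n f) _ _ (≤-trans (+-monoˡ-≤ _ (∑-mono-≤ n f≤g′)) (≤-reflexive ∑≡)))
    (f≤g (suc n) (s≤s z≤n) ≤-refl)
  helper : Dec (t ≡ suc n) → g t ≡ f t
  helper (yes refl) = last≡
  helper (no t≢)    = ∑-≡⇒pointwise n f≤g′ (+-cancelʳ-≡ (g (suc n)) _ _ (trans ∑≡ (cong (∑ n f +_) (sym last≡))))
                        t 1≤t (m≤1+n∧m≢1+n⇒m≤n t≤n t≢)

-- For indicators of nested sets, `x` is the one new element; it becomes the next value of the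
-- permutation.
∑-increment : ∀ n {f g} → (∀ t → 1 ≤ t → t ≤ n → f t ≤ g t) → ∑ n g ≡ suc (∑ n f) →
              ∃[ x ] (1 ≤ x × x ≤ n) × (∀ t → 1 ≤ t → t ≤ n → g t ≡ f t + 𝟙 (x ≟ t))
∑-increment (suc n) {f} {g} f≤g ∑≡ = helper (g (suc n) ≟ f (suc n))
  where
  f≤g′ : ∀ t → 1 ≤ t → t ≤ n → f t ≤ g t
  f≤g′ t 1≤t t≤n = f≤g t 1≤t (m≤n⇒m≤1+n t≤n)

  extend : ∀ {x} → g (suc n) ≡ f (suc n) + 𝟙 (x ≟ suc n) → (∀ t → 1 ≤ t → t ≤ n → g t ≡ f t + 𝟙 (x ≟ t)) →
           ∀ t → 1 ≤ t → t ≤ suc n → g t ≡ f t + 𝟙 (x ≟ t)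
  extend {x} last below t 1≤t t≤ = case (t ≟ suc n)
    where
    case : Dec (t ≡ suc n) → g t ≡ f t + 𝟙 (x ≟ t)
    case (yes refl) = last
    case (no t≢)    = below t 1≤t (m≤1+n∧m≢1+n⇒m≤n t≤ t≢)

  helper : Dec (g (suc n) ≡ f (suc n)) → ∃[ x ] (1 ≤ x × x ≤ suc n) × (∀ t → 1 ≤ t → t ≤ suc n → g t ≡ f t + 𝟙 (x ≟ t))
  helper (yes last≡) with x , (1≤x , x≤n) , g≡ ← ∑-increment n f≤g′ (+-cancelʳ-≡ (g (suc n)) _ _ (trans ∑≡ (cong (λ c → suc (∑ n f + c)) (sym last≡)))) =
    x , (1≤x , m≤n⇒m≤1+n x≤n) ,
    extend (trans last≡ (sym (trans (cong (f (suc n) +_) (𝟙-no (x ≟ suc n) (<⇒≢ (s≤s x≤n)))) (+-identityʳ _)))) g≡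
  helper (no last≢) = suc n , (s≤s z≤n , ≤-refl) ,
    extend (trans last≡ (sym (trans (cong (f (suc n) +_) (𝟙-yes (suc n ≟ suc n) refl)) (+-comm (f (suc n)) 1))))
      λ t 1≤t t≤n → trans (∑-≡⇒pointwise n f≤g′ init≡ t 1≤t t≤n)
        (sym (trans (cong (f t +_) (𝟙-no (suc n ≟ t) (<⇒≢ (s≤s t≤n) ∘ sym))) (+-identityʳ _)))
    where
    last≡ : g (suc n) ≡ suc (f (suc n))
    last≡ = ≤-antisym
      (+-cancelˡ-≤ (∑ n f) _ _ (≤-trans (+-monoˡ-≤ _ (∑-mono-≤ n f≤g′)) (≤-reflexive (trans ∑≡ (sym (+-suc (∑ n f) _))))))
      (≤∧≢⇒< (f≤g (suc n) (s≤s z≤n) ≤-refl) (last≢ ∘ sym))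
    init≡ : ∑ n g ≡ ∑ n f
    init≡ = +-cancelʳ-≡ (g (suc n)) _ _ (trans ∑≡ (trans (sym (+-suc (∑ n f) (f (suc n)))) (cong (∑ n f +_) (sym last≡))))

module FromSegments {n : ℕ} (E : Subset) (rp : InRp n E) where

  Candidate : ℕ → ℕ → ℕ → Set
  Candidate k i j = (1 ≤ i × i ≤ k × k < j × j ≤ n) × T (E i j)

  candidate? : ∀ k i j → Dec (Candidate k i j)
  candidate? k i j = (1 ≤? i ×-dec i ≤? k ×-dec k <? j ×-dec j ≤? n) ×-dec T? (E i j)

  -- The arcs at level k are chosen greedily by increasing length.  New k l i says
  -- that [i,i+l+1] is an arc, From k l i (resp. To k l i) that some arc of length
  -- at most l starts at i (resp. ends at i+l).
  From To New : ℕ → ℕ → ℕ → Set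
  From k zero    i = ⊥
  From k (suc l) i = From k l i ⊎ New k l i
  To k zero    i = ⊥
  To k (suc l) i = To k l (suc i) ⊎ New k l i
  New k l i = Candidate k i (suc (i + l)) × ¬ From k l i × ¬ To k l (suc i)

  from? : ∀ k l i → Dec (From k l i)
  to?   : ∀ k l i → Dec (To k l i)
  new?  : ∀ k l i → Dec (New k l i)
  from? k zero    i = no λ ()
  from? k (suc l) i = from? k l i ⊎-dec new? k l i
  to? k zero    i = no λ ()
  to? k (suc l) i = to? k l (suc i) ⊎-dec new? k l i
  new? k l i = candidate? k i (suc (i + l)) ×-dec ¬? (from? k l i) ×-dec ¬? (to? k l (suc i))

  from⇒new : ∀ {k i} l → From k l i → ∃[ l′ ] l′ < l × New k l′ i
  from⇒new (suc l) (inj₂ new) = l , ≤-refl , new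
  from⇒new (suc l) (inj₁ from) with l′ , l′<l , new ← from⇒new l from = l′ , m≤n⇒m≤1+n l′<l , new

  new⇒from : ∀ {k i l′} l → l′ < l → New k l′ i → From k l i
  new⇒from {l′ = l′} (suc l) l′<l new with l′ ≟ l
  ... | yes refl = inj₂ new
  ... | no l′≢l  = inj₁ (new⇒from l (≤∧≢⇒< (≤-pred l′<l) l′≢l) new)

  to⇒new : ∀ {k} l i → To k l i → ∃[ i′ ] ∃[ l′ ] i ≤ i′ × i + l ≡ suc (i′ + l′) × New k l′ i′
  to⇒new (suc l) i (inj₂ new) = i , l , ≤-refl , +-suc i l , new
  to⇒new (suc l) i (inj₁ to) with i′ , l′ , i<i′ , eq , new ← to⇒new l (suc i) to = i′ , l′ , <⇒≤ i<i′ , trans (+-suc i l) eq , new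

  new⇒to : ∀ {k i′ l′} l i → i ≤ i′ → i + l ≡ suc (i′ + l′) → New k l′ i′ → To k l i
  new⇒to {i′ = i′} {l′} zero i i≤i′ eq new =
    contradiction (≤-trans (s≤s (≤-trans i≤i′ (m≤m+n i′ l′))) (≤-reflexive (trans (sym eq) (+-identityʳ i)))) (n≮n i)
  new⇒to {i′ = i′} {l′} (suc l) i i≤i′ eq new with i ≟ i′
  ... | yes refl with refl ← +-cancelˡ-≡ i l l′ (suc-injective (trans (sym (+-suc i l)) eq)) = inj₂ new
  ... | no i≢i′ = inj₁ (new⇒to l (suc i) (≤∧≢⇒< i≤i′ i≢i′) (trans (sym (+-suc i l)) eq) new)

  abstract
    -- `New` in terms of endpoints. Being abstract, it hides the recursion on lengths behind
    -- `arc-hook` and the lemmas around it.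
    Arc : ℕ → ℕ → ℕ → Set
    Arc k i j = i < j × New k (j ∸ suc i) i

    arc? : ∀ k i j → Dec (Arc k i j)
    arc? k i j = i <? j ×-dec new? k (j ∸ suc i) i

    private
      new⇒arc : ∀ {k i l} → New k l i → Arc k i (suc (i + l))
      new⇒arc {k} {i} {l} new = s≤s (m≤m+n i l) , subst (λ l → New k l i) (sym (m+n∸m≡n i l)) new

    arc⇒candidate : ∀ {k i j} → Arc k i j → Candidate k i j
    arc⇒candidate {k} {i} (i<j , cand , _) = subst (Candidate k i) (m+[n∸m]≡n i<j) cand

    -- The greedy rule rejects a candidate only if a shorter arc shares its left or its right end.
    arc-hook : ∀ {k i j} → Candidate k i j → (∃[ i′ ] i ≤ i′ × Arc k i′ j) ⊎ (∃[ j′ ] j′ ≤ j × Arc k i j′)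
    arc-hook {k} {i} {j} cand@((_ , i≤k , k<j , _) , _) with span l ← toSpan (≤-<-trans i≤k k<j) =
      helper (from? k l i) (to? k l (suc i))
      where
      helper : Dec (From k l i) → Dec (To k l (suc i)) → (∃[ i′ ] i ≤ i′ × Arc k i′ (suc (i + l))) ⊎ (∃[ j′ ] j′ ≤ suc (i + l) × Arc k i j′)
      helper (yes from) _ with l′ , l′<l , new ← from⇒new l from = inj₂ (suc (i + l′) , s≤s (+-monoʳ-≤ i (<⇒≤ l′<l)) , new⇒arc new)
      helper (no _) (yes to) with i′ , l′ , i<i′ , eq , new ← to⇒new l (suc i) to =
        inj₁ (i′ , <⇒≤ i<i′ , subst (Arc k i′) (sym eq) (new⇒arc new))
      helper (no ¬from) (no ¬to) = inj₁ (i , ≤-refl , new⇒arc (cand , ¬from , ¬to))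

    arc-no-shorter-right : ∀ {k i j j′} → Arc k i j → Arc k i j′ → ¬ j′ < j
    arc-no-shorter-right (i<j , _ , ¬from , _) (i<j′ , new) j′<j = ¬from (new⇒from _ (∸-monoˡ-< j′<j i<j′) new)

    arc-no-shorter-left : ∀ {k i i′ j} → Arc k i j → Arc k i′ j → ¬ i < i′
    arc-no-shorter-left {i = i} {i′} {j} (i<j , _ , _ , ¬to) (i′<j , new) i<i′ =
      ¬to (new⇒to (j ∸ suc i) (suc i) i<i′ (trans (m+[n∸m]≡n i<j) (sym (m+[n∸m]≡n i′<j))) new)

  arc-bounds : ∀ {k i j} → Arc k i j → 1 ≤ i × i ≤ k × k < j × j ≤ n
  arc-bounds = proj₁ ∘ arc⇒candidate

  arc⇒E : ∀ {k i j} → Arc k i j → T (E i j)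
  arc⇒E = proj₂ ∘ arc⇒candidate

  arc⇒valid : ∀ {k i j} → Arc k i j → Valid n i j
  arc⇒valid A with 1≤i , i≤k , k<j , j≤n ← arc-bounds A = 1≤i , ≤-<-trans i≤k k<j , j≤n

  right-unique : ∀ {k i j j′} → Arc k i j → Arc k i j′ → j ≡ j′
  right-unique A A′ = ≤-antisym (≮⇒≥ (arc-no-shorter-right A A′)) (≮⇒≥ (arc-no-shorter-right A′ A))

  left-unique : ∀ {k i i′ j} → Arc k i j → Arc k i′ j → i ≡ i′
  left-unique A A′ = ≤-antisym (≮⇒≥ (arc-no-shorter-left A′ A)) (≮⇒≥ (arc-no-shorter-left A A′))

  meet : ∀ {i j i′ j′} → Valid n i j → Valid n i′ j′ → T (E i j) → T (E i′ j′) → i ≤ i′ → j ≤ j′ → i′ ≤ j →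
         i′ < j × T (E i′ j)
  meet {i} {j} {i′} {j′} v v′ ∈E ∈E′ i≤i′ j≤j′ i′≤j =
    subst₂ (λ p q → p < q × T (E p q)) max≡ min≡
      (rp i j i′ j′ v v′ ∈E ∈E′ (subst₂ _≤_ (sym max≡) (sym min≡) i′≤j))
    where
    max≡ = m≤n⇒m⊔n≡n i≤i′
    min≡ = m≤n⇒m⊓n≡m j≤j′

  -- If i < i′ and j < j′, then [i′,j] lies in E and is a candidate. The arc that it forces ends at
  -- j but starts after i, or starts at i′ but ends before j′; either way uniqueness of ends fails.
  antichain : ∀ {k i j i′ j′} → Arc k i j → Arc k i′ j′ → i ≤ i′ → j ≤ j′ → i ≡ i′ × j ≡ j′
  antichain {k} {i} {j} {i′} {j′} A A′ i≤i′ j≤j′ with i ≟ i′ | j ≟ j′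
  ... | yes refl | _        = refl , right-unique A A′
  ... | no _     | yes refl = left-unique A A′ , refl
  ... | no i≢i′  | no j≢j′ with arc-hook candidate
    where
    candidate : Candidate k i′ j
    candidate with _ , _ , k<j , j≤n ← arc-bounds A | 1≤i′ , i′≤k , _ ← arc-bounds A′ =
      (1≤i′ , i′≤k , k<j , j≤n) ,
      proj₂ (meet (arc⇒valid A) (arc⇒valid A′) (arc⇒E A) (arc⇒E A′) i≤i′ j≤j′ (≤-trans i′≤k (<⇒≤ k<j)))
  ... | inj₁ (i″ , i′≤i″ , A″) = contradiction (left-unique A A″) (<⇒≢ (<-≤-trans (≤∧≢⇒< i≤i′ i≢i′) i′≤i″))
  ... | inj₂ (j″ , j″≤j , A″)  = contradiction (right-unique A″ A′) (<⇒≢ (≤-<-trans j″≤j (≤∧≢⇒< j≤j′ j≢j′)))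

  arcSystem : ArcSystem n
  arcSystem = record { Arc = Arc ; arc? = arc? ; bounds = arc-bounds ; antichain = antichain }

  hook : ∀ {k i j} → Valid n i j → T (E i j) → i ≤ k → k < j →
         (∃[ i′ ] i ≤ i′ × Arc k i′ j) ⊎ (∃[ j′ ] j′ ≤ j × Arc k i j′)
  hook (1≤i , _ , j≤n) ∈E i≤k k<j = arc-hook ((1≤i , i≤k , k<j , j≤n) , ∈E)

  -- Descent on the right end. At level k the segment [i,m′] forces an arc [i″,m′] with i < i″, and
  -- at level k + 1 this forces an arc [i″,m‴] with m‴ < m′: the same situation with m′ in place of
  -- m. All other cases violate uniqueness of ends.
  no-shorter-next : ∀ {k i m m′} → Arc k i m → Arc (suc k) i m′ → ¬ m′ < m
  no-shorter-next {m = m} = go (<-wellFounded m)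
    where
    go : ∀ {k i m m′} → Acc _<_ m → Arc k i m → Arc (suc k) i m′ → ¬ m′ < m
    go {k} {i} {m} {m′} (acc rec) A A⁺ m′<m
      with _ , i≤k , _ ← arc-bounds A | _ , _ , k⁺<m′ , _ ← arc-bounds A⁺
      with hook (arc⇒valid A⁺) (arc⇒E A⁺) i≤k (<⇒≤ k⁺<m′)
    ... | inj₂ (m″ , m″≤m′ , A″) = <⇒≢ (≤-<-trans m″≤m′ m′<m) (right-unique A″ A)
    ... | inj₁ (i″ , i≤i″ , A″) with i ≟ i″
    ... | yes refl = <⇒≢ m′<m (right-unique A″ A)
    ... | no i≢i″ with hook (arc⇒valid A″) (arc⇒E A″) (m≤n⇒m≤1+n (proj₁ (proj₂ (arc-bounds A″)))) k⁺<m′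
    ... | inj₁ (i‴ , i″≤i‴ , A‴) = <⇒≢ (<-≤-trans (≤∧≢⇒< i≤i″ i≢i″) i″≤i‴) (left-unique A⁺ A‴)
    ... | inj₂ (m‴ , m‴≤m′ , A‴) with m‴ ≟ m′
    ... | yes refl = i≢i″ (left-unique A⁺ A‴)
    ... | no m‴≢m′ = go (rec m′<m) A″ A‴ (≤∧≢⇒< m‴≤m′ m‴≢m′)

  -- Otherwise level k has an arc [i′,l] with i < i′, which at level k + 1 forces an arc from i′
  -- ending before l, against `no-shorter-next`.
  from-previous : ∀ {k i l} → Arc (suc k) i l → i ≤ k → ∃[ l′ ] Arc k i l′
  from-previous {k} {i} {l} A⁺ i≤k with _ , _ , k⁺<l , _ ← arc-bounds A⁺ with hook (arc⇒valid A⁺) (arc⇒E A⁺) i≤k (<⇒≤ k⁺<l)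
  ... | inj₂ (l′ , _ , A) = l′ , A
  ... | inj₁ (i′ , i≤i′ , A) with i ≟ i′
  ... | yes refl = l , A
  ... | no i≢i′ with hook (arc⇒valid A) (arc⇒E A) (m≤n⇒m≤1+n (proj₁ (proj₂ (arc-bounds A)))) k⁺<l
  ... | inj₁ (i″ , i′≤i″ , A″) = contradiction (left-unique A⁺ A″) (<⇒≢ (<-≤-trans (≤∧≢⇒< i≤i′ i≢i′) i′≤i″))
  ... | inj₂ (l″ , l″≤l , A″) with l″ ≟ l
  ... | yes refl = contradiction (left-unique A⁺ A″) i≢i′
  ... | no l″≢l  = contradiction (≤∧≢⇒< l″≤l l″≢l) (no-shorter-next A A″)

  Member : ℕ → ℕ → Set
  Member k m = (m ≤ k × ¬ (∃[ j ] Arc k m j)) ⊎ (k < m × ∃[ i ] Arc k i m)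

  member-suc : ∀ {k m} → Member k m → Member (suc k) m
  member-suc (inj₁ (m≤k , none)) = inj₁ (m≤n⇒m≤1+n m≤k , λ (_ , A⁺) → none (from-previous A⁺ m≤k))
  member-suc {k} {m} (inj₂ (k<m , i , A)) with suc k ≟ m
  -- Segments [i,m] and [m,l] of E would intersect in the single point m, which R_p forbids.
  ... | yes refl = inj₁ (≤-refl , λ (l , A⁺) →
    let _ , i<m , _ = arc⇒valid A
        _ , m<l , _ = arc⇒valid A⁺
    in <-irrefl refl (proj₁ (meet (arc⇒valid A) (arc⇒valid A⁺) (arc⇒E A) (arc⇒E A⁺) (<⇒≤ i<m) (<⇒≤ m<l) ≤-refl)))
  ... | no k⁺≢m with k⁺<m ← ≤∧≢⇒< k<m k⁺≢m
                with hook (arc⇒valid A) (arc⇒E A) (m≤n⇒m≤1+n (proj₁ (proj₂ (arc-bounds A)))) k⁺<m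
  ... | inj₁ (i′ , _ , A⁺) = inj₂ (k⁺<m , i′ , A⁺)
  ... | inj₂ (m′ , m′≤m , A⁺) with m′ ≟ m
  ... | yes refl = inj₂ (k⁺<m , i , A⁺)
  ... | no m′≢m  = contradiction (≤∧≢⇒< m′≤m m′≢m) (no-shorter-next A A⁺)

  abstract
    arcFrom? : ∀ k m → Dec (∃[ j ] Arc k m j)
    arcFrom? k m = map′ (λ (j , _ , A) → j , A) (λ (j , A) → j , s≤s (proj₂ (proj₂ (proj₂ (arc-bounds A)))) , A)
                     (anyUpTo? (arc? k m) (suc n))

    arcTo? : ∀ k m → Dec (∃[ i ] Arc k i m)
    arcTo? k m = map′ (λ (i , _ , A) → i , A) (λ (i , A) → i , s≤s (proj₁ (proj₂ (arc-bounds A))) , A)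
                   (anyUpTo? (λ i → arc? k i m) (suc k))

    member? : ∀ k m → Dec (Member k m)
    member? k m = (m ≤? k ×-dec ¬? (arcFrom? k m)) ⊎-dec (k <? m ×-dec arcTo? k m)

  mem : ℕ → ℕ → ℕ
  mem k m = 𝟙 (member? k m)

  mem-suc : ∀ k m → mem k m ≤ mem (suc k) m
  mem-suc k m with member? k m
  ... | no _  = z≤n
  ... | yes p = ≤-reflexive (sym (𝟙-yes (member? (suc k) m) (member-suc p)))

  mem-zero : ∀ m → 1 ≤ m → mem 0 m ≡ 0
  mem-zero m 1≤m = 𝟙-no (member? 0 m) λ where
    (inj₁ (m≤0 , _))   → contradiction (≤-trans 1≤m m≤0) λ ()
    (inj₂ (_ , _ , A)) → let 1≤i , i≤0 , _ = arc-bounds A in contradiction (≤-trans 1≤i i≤0) λ ()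

  exchanged : ∀ k m → ArcSystem.Exchanged arcSystem k m (mem k m)
  exchanged k m = record { low = low (arcFrom? k m) ; high = high (arcTo? k m) }
    where
    low : Dec (∃[ j ] Arc k m j) → m ≤ k → (mem k m ≡ 1 × (∀ j → ¬ Arc k m j)) ⊎ (mem k m ≡ 0 × ∃[ j ] Arc k m j)
    low (no none)  m≤k = inj₁ (𝟙-yes (member? k m) (inj₁ (m≤k , none)) , λ j A → none (j , A))
    low (yes some) m≤k = inj₂ (𝟙-no (member? k m) (λ { (inj₁ (_ , none)) → none some ; (inj₂ (k<m , _)) → <⇒≱ k<m m≤k }) , some)
    high : Dec (∃[ i ] Arc k i m) → k < m → (mem k m ≡ 0 × (∀ i → ¬ Arc k i m)) ⊎ (mem k m ≡ 1 × ∃[ i ] Arc k i m)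
    high (no none)  k<m = inj₁ (𝟙-no (member? k m) (λ { (inj₁ (m≤k , _)) → <⇒≱ k<m m≤k ; (inj₂ (_ , some)) → none some }) , λ i A → none (i , A))
    high (yes some) k<m = inj₂ (𝟙-yes (member? k m) (inj₂ (k<m , some)) , some)

  -- Summed over all m, `balance` counts each arc once on either side, by its right and by its left
  -- end, so the arcs cancel.
  ∑-mem : ∀ {k} → k ≤ n → ∑ n (mem k) ≡ k
  ∑-mem {k} k≤n = +-cancelʳ-≡ (∑ n (λ m → ∑ n (arcs k m))) _ _ (begin
    ∑ n (mem k) + ∑ n (λ m → ∑ n (arcs k m))                      ≡⟨ ∑-+ n _ _ ⟨
    ∑ n (λ m → mem k m + ∑ n (arcs k m))                          ≡⟨ ∑-cong n (λ m _ _ → balance (exchanged k m)) ⟨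
    ∑ n (λ m → 𝟙 (m ≤? k) + ∑ n (λ i → arcs k i m))               ≡⟨ ∑-+ n _ _ ⟩
    ∑ n (λ m → 𝟙 (m ≤? k)) + ∑ n (λ m → ∑ n (λ i → arcs k i m))   ≡⟨ cong₂ _+_ initial (∑-swap n n (λ m i → arcs k i m)) ⟩
    k + ∑ n (λ m → ∑ n (arcs k m))                                ∎)
    where
    open ≡-Reasoning
    open ArcSystem arcSystem using (arcs; balance)
    ∑-one : ∀ k → ∑ k (λ _ → 1) ≡ k
    ∑-one zero    = refl
    ∑-one (suc k) = trans (cong (_+ 1) (∑-one k)) (+-comm k 1)
    initial : ∑ n (λ m → 𝟙 (m ≤? k)) ≡ k
    initial = trans (∑-final-zeros _ k≤n λ m k<m _ → 𝟙-no (m ≤? k) (<⇒≱ k<m))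
      (trans (∑-cong k λ m _ m≤k → 𝟙-yes (m ≤? k) m≤k) (∑-one k))

  abstract
    added : ∀ k → k < n → ∃[ x ] (1 ≤ x × x ≤ n) × (∀ m → 1 ≤ m → m ≤ n → mem (suc k) m ≡ mem k m + 𝟙 (x ≟ m))
    added k k<n = ∑-increment n (λ m _ _ → mem-suc k m) (trans (∑-mem k<n) (cong suc (sym (∑-mem (<⇒≤ k<n)))))

  -- The value at k + 1 is the element by which the (k+1)-subset exceeds the k-subset; 0 is a
  -- default beyond `n`.
  choose : ∀ k → Dec (k < n) → ℕ
  choose k (yes k<n) = proj₁ (added k k<n)
  choose k (no _)    = 0

  perm : ℕ → ℕ
  perm zero    = 0
  perm (suc k) = choose k (k <? n)

  perm-range : ∀ t → 1 ≤ t → t ≤ n → 1 ≤ perm t × perm t ≤ n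
  perm-range (suc k) _ k<n with k <? n
  ... | yes p = proj₁ (proj₂ (added k p))
  ... | no ¬p = contradiction k<n ¬p

  mem-step : ∀ k m → k < n → 1 ≤ m → m ≤ n → mem (suc k) m ≡ mem k m + 𝟙 (perm (suc k) ≟ m)
  mem-step k m k<n 1≤m m≤n with k <? n
  ... | yes p = proj₂ (proj₂ (added k p)) m 1≤m m≤n
  ... | no ¬p = contradiction k<n ¬p

  members≡mem : ∀ k m → k ≤ n → 1 ≤ m → m ≤ n → members perm k m ≡ mem k m
  members≡mem zero    m _ 1≤m _ = sym (mem-zero m 1≤m)
  members≡mem (suc k) m k<n 1≤m m≤n = trans (cong (_+ 𝟙 (perm (suc k) ≟ m)) (members≡mem k m (<⇒≤ k<n) 1≤m m≤n)) (sym (mem-step k m k<n 1≤m m≤n))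

  -- A repeated value would be counted twice by `members`, which agrees with the indicator `mem`.
  perm-distinct : ∀ {i j} → 1 ≤ i → i < j → j ≤ n → perm i ≢ perm j
  perm-distinct {i} {suc j} 1≤i (s≤s i≤j) j<n eq = <⇒≱ (+-monoˡ-≤ 1 earlier) (begin
    members perm j m + 1         ≡⟨ cong (members perm j m +_) (𝟙-yes (m ≟ m) refl) ⟨
    members perm (suc j) m       ≡⟨ members≡mem (suc j) m j<n (proj₁ m-range) (proj₂ m-range) ⟩
    mem (suc j) m                ≤⟨ 𝟙≤1 (member? (suc j) m) ⟩
    1                            ∎)
    where
    open ≤-Reasoning
    m = perm (suc j)
    m-range = perm-range (suc j) (s≤s z≤n) j<n
    earlier : 1 ≤ members perm j m
    earlier = ≤-trans (∑-prefix-< (λ t → 𝟙 (perm t ≟ m)) 1≤i (𝟙-yes (perm i ≟ m) eq)) (∑-prefix-≤ _ i≤j)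

  perm-IsPerm : IsPerm n perm
  perm-IsPerm = perm-range , injective
    where
    injective : ∀ i j → 1 ≤ i → i ≤ n → 1 ≤ j → j ≤ n → perm i ≡ perm j → i ≡ j
    injective i j 1≤i i≤n 1≤j j≤n eq = ≤-antisym
      (≮⇒≥ λ j<i → perm-distinct 1≤j j<i i≤n (sym eq))
      (≮⇒≥ λ i<j → perm-distinct 1≤i i<j j≤n eq)

  members-exchanged : ∀ k m → k < n → 1 ≤ m → m ≤ n → ArcSystem.Exchanged arcSystem k m (members perm k m)
  members-exchanged k m k<n 1≤m m≤n =
    subst (ArcSystem.Exchanged arcSystem k m) (sym (members≡mem k m (<⇒≤ k<n) 1≤m m≤n)) (exchanged k m)

theorem1p2 : (n : ℕ) → 2 ≤ n → (a : ℕ → ℕ) →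
    ((w : ℕ → ℕ) → IsPerm n w →
    Σ[ T ∈ ZPt ] ((InΠ n a T × (μ n a T ≈w[ n ] wlam n a w))
    × IsVertex n a (toPt T)
    × Σ[ E ∈ Subset ] (InRp n E × IsXE n a E (toPt T))))
    × ((E : Subset) → InRp n E →
    Σ[ w ∈ (ℕ → ℕ) ] Σ[ T ∈ ZPt ] (IsPerm n w × InΠ n a T
    × (μ n a T ≈w[ n ] wlam n a w) × IsXE n a E (toPt T)))
theorem1p2 n 2≤n a = forward , backward
  where
  forward : (w : ℕ → ℕ) → IsPerm n w →
    Σ[ T ∈ ZPt ] ((InΠ n a T × (μ n a T ≈w[ n ] wlam n a w))
    × IsVertex n a (toPt T)
    × Σ[ E ∈ Subset ] (InRp n E × IsXE n a E (toPt T)))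
  forward w perm = pointℤ arcSystem a ,
    (pointℤ-InΠ arcSystem a , pointℤ-weight arcSystem w (proj₁ perm) exchanged a) ,
    InP∧IsXE⇒IsVertex {E = segments} (pointℤ-InΠ arcSystem a) isXE ,
    segments , segments-InRp , isXE
    where
    open FromPermutation perm (members w) (λ _ → refl) (λ _ _ → refl) (members≤1 perm)
    isXE : IsXE n a segments (toPt (pointℤ arcSystem a))
    isXE = pointℤ-IsXE arcSystem a segments arc⇒segment hook

  backward : (E : Subset) → InRp n E →
    Σ[ w ∈ (ℕ → ℕ) ] Σ[ T ∈ ZPt ] (IsPerm n w × InΠ n a T
    × (μ n a T ≈w[ n ] wlam n a w) × IsXE n a E (toPt T))
  backward E rp = perm , pointℤ arcSystem a , perm-IsPerm , pointℤ-InΠ arcSystem a ,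
    pointℤ-weight arcSystem perm perm-range members-exchanged a , pointℤ-IsXE arcSystem a E arc⇒E hook
    where open FromSegments E rp
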